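{- Let $\Phi=(C_n,\varphi)$ be a $\mathbb{T}$-gain digraph on the directed cycle $v_1\to v_2\to\cdots\to v_n\to v_1$. If $g=\varphi(C_n)=\prod_{i=1}^{n}\varphi(v_i,v_{i+1})$ (with $v_{n+1}=v_1$), then $\operatorname{spec}(A(\Phi))=\{\lambda\in\mathbb{C}:\lambda^n=g\}$ and $\rho(\Phi)=1$.
   Context: $C_n$ ($n\ge2$) is the digraph with distinct vertices $v_1,\dots,v_n$ and exactly the arcs $(v_i,v_{i+1})$, $1\le i\le n$, indices mod $n$. Let $\mathbb{T}=\{z\in\mathbb{C}:|z|=1\}$. A $\mathbb{T}$-gain digraph on a digraph $D$ is a pair $\Phi=(D,\varphi)$ where $\varphi$ assigns to each arc of $D$ an element of $\mathbb{T}$, arbitrarily. Its gain adjacency matrix $A(\Phi)$ has entries $A(\Phi)_{ij}=\varphi(v_i,v_j)$ if $(v_i,v_j)$ is an arc and $0$ otherwise. $\operatorname{spec}(M)$ is the multiset of complex eigenvalues of $M$ (here each of the $n$ roots occurs once), and $\rho(\Phi)$ is the spectral radius (maximum modulus of an eigenvalue) of $A(\Phi)$. -}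

module Defs where

open import Algebra.Apartness.Bundles using (HeytingField)
open import Algebra.Apartness.Structures using (IsHeytingField)
open import Algebra.Bundles.Raw using (RawRing)
open import Algebra.Core using (Op₁; Op₂)
import Algebra.Definitions.RawMonoid as RawMonoidDefinitions
import Algebra.Definitions.RawSemiring as RawSemiringDefinitions
open import Data.Bool.Base using (if_then_else_)
open import Data.Fin.Base using (Fin; zero; suc; toℕ; punchIn)
open import Data.Fin.Properties using (_≟_)
open import Data.Nat.Base as ℕ using (ℕ; zero; suc)
open import Data.Nat.DivMod using (_mod_)
open import Data.Product.Base using (∃-syntax; _×_; _,_)
open import Data.Sum.Base using (_⊎_)
open import Data.Vec.Functional using (Vector)
open import Function.Bundles using (_⇔_)
open import Level using (Level; _⊔_; 0ℓ) renaming (suc to lsuc)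
open import Relation.Binary.Core using (Rel)
open import Relation.Binary.Definitions using (Decidable)
open import Relation.Binary.PropositionalEquality.Core using (_≡_; _≢_; refl)
open import Relation.Binary.Structures using (IsStrictPartialOrder)
open import Relation.Nullary.Decidable.Core using (yes; no; does)
open import Relation.Nullary.Negation.Core using (¬_)

-- The real numbers, up to isomorphism: a Cauchy-complete Archimedean
-- ordered field.  The axioms are the constructive ones (x ≉ y is
-- witnessed by x < y or y < x, and < is cotransitive rather than
-- trichotomous), so they hold of the constructive reals; under excluded
-- middle they characterise the classical field ℝ.
record Reals c ℓ₁ ℓ₂ : Set (lsuc (c ⊔ ℓ₁ ⊔ ℓ₂)) where
  infix  8 -_
  infixl 7 _*_
  infixl 6 _+_
  infix  4 _≈_ _<_ _#_ _≤_
  field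
    Carrier : Set c
    _≈_     : Rel Carrier ℓ₁
    _<_     : Rel Carrier ℓ₂
    _+_     : Op₂ Carrier
    _*_     : Op₂ Carrier
    -_      : Op₁ Carrier
    0#      : Carrier
    1#      : Carrier

  _#_ : Rel Carrier ℓ₂
  x # y = x < y ⊎ y < x

  _≤_ : Rel Carrier ℓ₂
  x ≤ y = ¬ (y < x)

  rawRing : RawRing c ℓ₁
  rawRing = record
    { _≈_ = _≈_ ; _+_ = _+_ ; _*_ = _*_ ; -_ = -_ ; 0# = 0# ; 1# = 1# }

  open RawMonoidDefinitions (RawRing.+-rawMonoid rawRing) public
    using () renaming (_×_ to _·_)

  Cauchy : (ℕ → Carrier) → Set (c ⊔ ℓ₂)
  Cauchy x = ∀ ε → 0# < ε →
    ∃[ N ] (∀ m n → N ℕ.≤ m → N ℕ.≤ n → x m < x n + ε)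

  _ConvergesTo_ : (ℕ → Carrier) → Carrier → Set (c ⊔ ℓ₂)
  x ConvergesTo l = ∀ ε → 0# < ε →
    ∃[ N ] (∀ n → N ℕ.≤ n → x n < l + ε × l < x n + ε)

  field
    isHeytingField       : IsHeytingField _≈_ _#_ _+_ _*_ -_ 0# 1#
    isStrictPartialOrder : IsStrictPartialOrder _≈_ _<_
    +-monoˡ-<            : ∀ {x y} z → x < y → x + z < y + z
    *-pos                : ∀ {x y} → 0# < x → 0# < y → 0# < x * y
    archimedean          : ∀ x → ∃[ n ] (x < n · 1#)
    complete             : ∀ x → Cauchy x → ∃[ l ] (x ConvergesTo l)

  heytingField : HeytingField c ℓ₁ ℓ₂
  heytingField = record { isHeytingField = isHeytingField }

Matrix : ∀ {a} → Set a → ℕ → Set a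
Matrix A n = Fin n → Fin n → A

module MatrixAlgebra {c ℓ} (R : RawRing c ℓ) where

  open RawRing R
  open RawSemiringDefinitions rawSemiring using (_^_; sum)

  identity : ∀ {n} → Matrix Carrier n
  identity i j = if does (i ≟ j) then 1# else 0#

  _*ᵥ_ : ∀ {n} → Matrix Carrier n → Vector Carrier n → Vector Carrier n
  (M *ᵥ v) i = sum (λ j → M i j * v j)

  -- Laplace expansion along the first row.
  det : ∀ {n} → Matrix Carrier n → Carrier
  det {zero}  M = 1#
  det {suc n} M = sum (λ j →
    (- 1#) ^ toℕ j * (M zero j * det (λ i k → M (suc i) (punchIn j k))))

  -- The characteristic polynomial det(zI − M), as a polynomial function.
  charPoly : ∀ {n} → Matrix Carrier n → Carrier → Carrier
  charPoly M z = det (λ i j → z * identity i j + - M i j)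

record Digraph (n : ℕ) : Set₁ where
  field
    Arc  : Rel (Fin n) 0ℓ
    arc? : Decidable Arc

next : ∀ {n} → Fin n → Fin n
next {suc n} i = suc (toℕ i) mod suc n

-- The vertices v₁, …, vₙ are represented by 0, …, n − 1.
directedCycle : ∀ n → Digraph n
directedCycle n = record
  { Arc  = λ i j → j ≡ next i
  ; arc? = λ i j → j ≟ next i
  }

module Complex {c ℓ₁ ℓ₂} (ℝ : Reals c ℓ₁ ℓ₂) where

  private module ℝ = Reals ℝ

  infix 4 _#_ _HasModulus_

  record ℂ : Set c where
    constructor _+i_
    field
      re im : ℝ.Carrier

  open ℂ public

  ℂ-rawRing : RawRing c ℓ₁
  ℂ-rawRing = record
    { Carrier = ℂ
    ; _≈_     = λ z w → re z ℝ.≈ re w × im z ℝ.≈ im w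
    ; _+_     = λ z w → (re z ℝ.+ re w) +i (im z ℝ.+ im w)
    ; _*_     = λ z w → (re z ℝ.* re w ℝ.+ ℝ.- (im z ℝ.* im w))
                     +i (re z ℝ.* im w ℝ.+ im z ℝ.* re w)
    ; -_      = λ z → (ℝ.- re z) +i (ℝ.- im z)
    ; 0#      = ℝ.0# +i ℝ.0#
    ; 1#      = ℝ.1# +i ℝ.0#
    }

  open RawRing ℂ-rawRing public using (_≈_; _+_; _*_; -_; 0#; 1#)
  open RawSemiringDefinitions (RawRing.rawSemiring ℂ-rawRing) public
    using (_^_; sum; product)
  open MatrixAlgebra ℂ-rawRing public

  -- The constructive form of z ≠ w.
  _#_ : Rel ℂ ℓ₂
  z # w = re z ℝ.# re w ⊎ im z ℝ.# im w

  -- Relational, since Reals has no square root operation; completeness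
  -- ensures that every z has a modulus.
  _HasModulus_ : ℂ → ℝ.Carrier → Set (ℓ₁ ⊔ ℓ₂)
  z HasModulus r =
    ℝ.0# ℝ.≤ r × r ℝ.* r ℝ.≈ re z ℝ.* re z ℝ.+ im z ℝ.* im z

  record 𝕋 : Set (c ⊔ ℓ₁ ⊔ ℓ₂) where
    field
      value   : ℂ
      modulus : value HasModulus ℝ.1#

  IsEigenvalue : ∀ {n} → Matrix ℂ n → ℂ → Set (c ⊔ ℓ₁ ⊔ ℓ₂)
  IsEigenvalue {n} M μ = ∃[ v ] (∃[ i ] (v i # 0#))
                              × (∀ i → (M *ᵥ v) i ≈ μ * v i)

  -- μs lists the eigenvalues of M with algebraic multiplicity.
  IsSpectrum : ∀ {n} → Matrix ℂ n → Vector ℂ n → Set (c ⊔ ℓ₁)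
  IsSpectrum M μs = ∀ z → charPoly M z ≈ product (λ i → z + - μs i)

  -- The multiset spec(M) is the set S, every element having multiplicity 1.
  SpecIsSet : ∀ {n ℓ} → Matrix ℂ n → (ℂ → Set ℓ) → Set (c ⊔ ℓ₁ ⊔ ℓ₂ ⊔ ℓ)
  SpecIsSet {n} M S = ∃[ μs ] IsSpectrum M μs
                            × (∀ i j → i ≢ j → μs i # μs j)
                            × (∀ z → S z ⇔ (∃[ i ] (z ≈ μs i)))

  IsSpectralRadius : ∀ {n} → Matrix ℂ n → ℝ.Carrier → Set (c ⊔ ℓ₁ ⊔ ℓ₂)
  IsSpectralRadius M ρ =
      (∃[ μ ] IsEigenvalue M μ × μ HasModulus ρ)
    × (∀ μ r → IsEigenvalue M μ → μ HasModulus r → r ℝ.≤ ρ)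

  -- The irrelevant argument makes the gain a function of the pair (i , j).
  record GainDigraph {n} (D : Digraph n) : Set (c ⊔ ℓ₁ ⊔ ℓ₂) where
    open Digraph D
    field
      gain : ∀ i j → .(Arc i j) → 𝕋

    adjacency : Matrix ℂ n
    adjacency i j with arc? i j
    ... | yes a = 𝕋.value (gain i j a)
    ... | no  _ = 0#

  open GainDigraph public using (gain; adjacency)

  cycleGain : ∀ {n} → GainDigraph (directedCycle n) → ℂ
  cycleGain Φ = product (λ i → 𝕋.value (gain Φ i (next i) refl))

{-# OPTIONS --safe #-}

-- Expanding det(zI − A) along its first row leaves an upper triangular minor
-- and a minor that collapses to a single product, so the characteristic
-- polynomial is zⁿ − g, and everything reduces to exhibiting n pairwise apart
-- n-th roots of g; a monic polynomial of degree n is then the product of the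
-- corresponding linear factors.
--
-- Without exponentials, roots come from angle bisection.  If |g₀| = 1 and
-- Re g₀ ≥ 0, then gₖ₊₁ = (1 + gₖ)/|1 + gₖ| squares to gₖ and tends to 1
-- geometrically; with aₖ = ⌈2ᵏ/n⌉ − 1 the powers gₖ ^ aₖ converge to an n-th root of
-- g₀.  All powers gₖ ^ m with m ≤ 2ᵏ stay between 1 and g₀.  For g₀ = i this
-- puts ζ, …, ζⁿ⁻¹ in the open first quadrant, where |z⁴ − 1| > 0, so ζ⁴ is a
-- primitive n-th root of unity.
--
-- An eigenvector for μ is vᵢ = μⁱ φᵢ ⋯ φₙ₋₁; conversely Av = λv scales |vᵢ|²
-- by |λ|² along every arc, and summing over the cycle gives |λ|² = 1.

module Submission where

import Algebra.Apartness.Properties.HeytingCommutativeRing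
import Algebra.Properties.CommutativeMonoid.Sum
import Algebra.Properties.CommutativeSemiring.Exp
import Algebra.Properties.Ring
import Algebra.Properties.Semiring.Exp
import Algebra.Properties.Semiring.Mult.TCOptimised
import Algebra.Properties.Semiring.Sum
import Algebra.Solver.Ring
import Data.Fin.Properties as Fin
import Data.Integer.Properties as ℤ
import Data.Nat.Properties as ℕ
import Data.Nat.Solver
import Data.Sum.Base as Sum
import Relation.Binary.Reasoning.Setoid
open import Algebra.Apartness.Bundles using (HeytingField)
open import Algebra.Apartness.Structures using (IsHeytingField)
open import Algebra.Bundles using (CommutativeRing)
open import Algebra.Solver.Ring.AlmostCommutativeRing
  using (fromCommutativeRing; _-Raw-AlmostCommutative⟶_)
open import Data.Empty using (⊥-elim)
open import Data.Fin.Base using (Fin; zero; suc; toℕ; punchIn; inject₁; fromℕ)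
open import Data.Fin.Relation.Unary.Top using (view; ‵fromℕ; ‵inject₁)
open import Data.Integer.Base as ℤ using (ℤ; +_; -[1+_])
open import Data.Maybe.Base using (Maybe; just; nothing)
open import Data.Nat.Base as ℕ using (ℕ; zero; suc; z≤n; s≤s)
open import Data.Nat.DivMod using (m<n⇒m%n≡m; n%n≡0)
open import Data.Product.Base using (Σ-syntax; ∃-syntax; _×_; _,_; proj₁; proj₂)
open import Data.Sum.Base using (_⊎_; inj₁; inj₂; [_,_]′)
open import Data.Vec.Base using (Vec; []; _∷_; replicate)
open import Data.Vec.Functional using (Vector)
open import Function.Base using (_∘_)
open import Function.Bundles using (mk⇔)
open import Level using (_⊔_)
open import Relation.Binary.Definitions using (tri<; tri≈; tri>)
open import Relation.Binary.PropositionalEquality.Core as ≡ using (_≡_; _≢_)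
open import Relation.Binary.Structures using (IsStrictPartialOrder)
open import Relation.Nullary.Decidable.Core using (yes; no)
open import Relation.Nullary.Negation.Core using (¬_)
open import Defs

-- The axioms of ℝ are constructive: equality and signs are undecidable, `<` is only cotransitive,
-- and limits preserve weak inequalities only. Three turns of the proof come from this. A general
-- gain g cannot be sorted by the sign of its real part, so it is treated by two overlapping cases.
-- The powers of ζ are first placed in the closed quadrant, a condition that survives the limit, and
-- strictness is regained from ζⁿ = i: Im ζⁿ = 1 forces Im ζ > 0, and ζᵐ ζⁿ⁻ᵐ = i exchanges real and
-- imaginary parts. Finally, the roots must be apart and not merely unequal, since apartness is what
-- permits cancelling their differences in a factorisation and finding out which root a given
-- solution of zⁿ = g is. The exponent aₖ is the quotient of 2ᵏ by n with a remainder sₖ ≤ n, so (gₖ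
-- ^ aₖ)ⁿ gₖ ^ sₖ = g₀. The sₖ are bounded and gₖ tends to 1, so the second factor disappears in the
-- limit.

-- The stdlib ring solver cancels only when it can decide equality of
-- coefficients, which the carrier of R cannot, so coefficients are integers.
-- Below, definitions whose proofs call the solver are opaque, because
-- unfolding such a proof during with-abstraction is very expensive.
module IntegerRingSolver {c ℓ} (R : CommutativeRing c ℓ) where
  open CommutativeRing R
  open Algebra.Properties.Ring ring using (-‿involutive; -0#≈0#; -‿distribˡ-*; -‿distribʳ-*; -‿+-comm)
  open Algebra.Properties.Semiring.Mult.TCOptimised semiring
    using (×-homo-+; 1+×; ×1-homo-*) renaming (_×_ to _·_)
  open Relation.Binary.Reasoning.Setoid setoid

  ⟦_⟧ℤ : ℤ → Carrier
  ⟦ + n ⟧ℤ      = n · 1#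
  ⟦ -[1+ n ] ⟧ℤ = - (suc n · 1#)

  private
    cancel-1 : ∀ x y → x - y ≈ (1# + x) - (1# + y)
    cancel-1 x y = begin
      x - y                         ≈⟨ +-congʳ (+-identityʳ x) ⟨
      (x + 0#) - y                  ≈⟨ +-congʳ (+-congˡ (-‿inverseʳ 1#)) ⟨
      (x + (1# - 1#)) - y           ≈⟨ +-congʳ (+-assoc x 1# (- 1#)) ⟨
      ((x + 1#) - 1#) - y           ≈⟨ +-assoc (x + 1#) (- 1#) (- y) ⟩
      (x + 1#) + (- 1# - y)         ≈⟨ +-cong (+-comm x 1#) (-‿+-comm 1# y) ⟩
      (1# + x) - (1# + y)           ∎

  ⊖-homo : ∀ m n → ⟦ m ℤ.⊖ n ⟧ℤ ≈ m · 1# - n · 1#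
  ⊖-homo m zero = begin
    m · 1#      ≈⟨ +-identityʳ _ ⟨
    m · 1# + 0# ≈⟨ +-congˡ -0#≈0# ⟨
    m · 1# - 0# ∎
  ⊖-homo zero (suc n) = sym (+-identityˡ _)
  ⊖-homo (suc m) (suc n) rewrite ℤ.[1+m]⊖[1+n]≡m⊖n m n = begin
    ⟦ m ℤ.⊖ n ⟧ℤ                  ≈⟨ ⊖-homo m n ⟩
    m · 1# - n · 1#               ≈⟨ cancel-1 _ _ ⟩
    (1# + m · 1#) - (1# + n · 1#) ≈⟨ +-cong (1+× m 1#) (-‿cong (1+× n 1#)) ⟨
    suc m · 1# - suc n · 1#       ∎

  +-homo : ∀ i j → ⟦ i ℤ.+ j ⟧ℤ ≈ ⟦ i ⟧ℤ + ⟦ j ⟧ℤ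
  +-homo (+ m) (+ n) = ×-homo-+ 1# m n
  +-homo (+ m) -[1+ n ] = ⊖-homo m (suc n)
  +-homo -[1+ m ] (+ n) = trans (⊖-homo n (suc m)) (+-comm _ _)
  +-homo -[1+ m ] -[1+ n ] = begin
    - (suc (suc (m ℕ.+ n)) · 1#)       ≡⟨ ≡.cong (λ k → - (suc k · 1#)) (ℕ.+-suc m n) ⟨
    - ((suc m ℕ.+ suc n) · 1#)         ≈⟨ -‿cong (×-homo-+ 1# (suc m) (suc n)) ⟩
    - (suc m · 1# + suc n · 1#)        ≈⟨ -‿+-comm _ _ ⟨
    (- (suc m · 1#)) + (- (suc n · 1#)) ∎

  -‿homo : ∀ i → ⟦ ℤ.- i ⟧ℤ ≈ - ⟦ i ⟧ℤ
  -‿homo (+ zero)  = sym -0#≈0#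
  -‿homo (+ suc n) = refl
  -‿homo -[1+ n ]  = sym (-‿involutive _)

  private
    pos-*-homo : ∀ m n → ⟦ + m ℤ.* + n ⟧ℤ ≈ m · 1# * n · 1#
    pos-*-homo m n rewrite ≡.sym (ℤ.pos-* m n) = ×1-homo-* m n

  *-homo : ∀ i j → ⟦ i ℤ.* j ⟧ℤ ≈ ⟦ i ⟧ℤ * ⟦ j ⟧ℤ
  *-homo (+ m) (+ n) = pos-*-homo m n
  *-homo (+ m) -[1+ n ] rewrite ≡.sym (ℤ.neg-distribʳ-* (+ m) (+ suc n)) =
    trans (-‿homo (+ m ℤ.* + suc n))
      (trans (-‿cong (pos-*-homo m (suc n))) (-‿distribʳ-* _ _))
  *-homo -[1+ m ] (+ n) rewrite ≡.sym (ℤ.neg-distribˡ-* (+ suc m) (+ n)) =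
    trans (-‿homo (+ suc m ℤ.* + n))
      (trans (-‿cong (pos-*-homo (suc m) n)) (-‿distribˡ-* _ _))
  *-homo -[1+ m ] -[1+ n ] = begin
    (suc m ℕ.* suc n) · 1#              ≈⟨ ×1-homo-* (suc m) (suc n) ⟩
    suc m · 1# * suc n · 1#             ≈⟨ -‿involutive _ ⟨
    - - (suc m · 1# * suc n · 1#)       ≈⟨ -‿cong (-‿distribˡ-* _ _) ⟩
    - ((- (suc m · 1#)) * suc n · 1#)   ≈⟨ -‿distribʳ-* _ _ ⟩
    (- (suc m · 1#)) * (- (suc n · 1#)) ∎

  morphism : ℤ.+-*-rawRing -Raw-AlmostCommutative⟶ fromCommutativeRing R
  morphism = record
    { ⟦_⟧ = ⟦_⟧ℤ ; +-homo = +-homo ; *-homo = *-homo ; -‿homo = -‿homo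
    ; 0-homo = refl ; 1-homo = refl }

  private
    coeff≟ : ∀ i j → Maybe (⟦ i ⟧ℤ ≈ ⟦ j ⟧ℤ)
    coeff≟ i j with i ℤ.≟ j
    ... | yes ≡.refl = just refl
    ... | no _       = nothing

  open Algebra.Solver.Ring ℤ.+-*-rawRing (fromCommutativeRing R) morphism coeff≟
    public using (solve; con; _:=_; _:+_; _:*_; _:-_; :-_)

-- The cyclic successor on indices

next-inject₁ : ∀ {m} (i : Fin m) → next (inject₁ i) ≡ suc i
next-inject₁ {m} i = Fin.toℕ-injective (≡.trans (Fin.toℕ-fromℕ< _)
  (≡.trans (m<n⇒m%n≡m (s≤s (≡.subst (ℕ._< m) (≡.sym (Fin.toℕ-inject₁ i)) (Fin.toℕ<n i))))
           (≡.cong suc (Fin.toℕ-inject₁ i))))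

next-fromℕ : ∀ m → next (fromℕ m) ≡ zero
next-fromℕ m = Fin.toℕ-injective (≡.trans (Fin.toℕ-fromℕ< _)
  (≡.trans (≡.cong (λ k → suc k ℕ.% suc m) (Fin.toℕ-fromℕ m)) (n%n≡0 (suc m))))

-- Deleting row 0 and column 1 contracts the arc out of vertex 0: row `i` of the minor again has its
-- gain in column `next i`.
punchIn₁-next : ∀ {m} (i : Fin (suc m)) → punchIn (suc zero) (next i) ≡ next (suc i)
punchIn₁-next i with view i
... | ‵fromℕ {m} = ≡.trans (≡.cong (punchIn (suc zero)) (next-fromℕ m)) (≡.sym (next-fromℕ (suc m)))
... | ‵inject₁ j = ≡.trans (≡.cong (punchIn (suc zero)) (next-inject₁ j)) (≡.sym (next-inject₁ (suc j)))

toℕ-next≤ : ∀ {m} (i : Fin (suc m)) → toℕ (next i) ℕ.≤ suc (toℕ i)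
toℕ-next≤ i with view i
... | ‵fromℕ {m} rewrite next-fromℕ m = z≤n
... | ‵inject₁ j rewrite next-inject₁ j = s≤s (ℕ.≤-reflexive (≡.sym (Fin.toℕ-inject₁ j)))

-- Without vertex 0 the cycle becomes a path whose arcs all go up; the only descending arc ends in
-- the deleted vertex.
next-suc≢ : ∀ {m} (i j : Fin (suc m)) → toℕ j ℕ.< toℕ i → suc j ≢ next (suc i)
next-suc≢ i j j<i eq with view i
... | ‵fromℕ {m} = Fin.0≢1+n (≡.sym (≡.trans eq (next-fromℕ (suc m))))
... | ‵inject₁ k = ℕ.<-irrefl ≡.refl (ℕ.<-trans j<i i<j)
  where
  i<j : toℕ (inject₁ k) ℕ.< toℕ j
  i<j = ≡.subst (ℕ._≤ toℕ j) (≡.cong suc (≡.sym (Fin.toℕ-inject₁ k)))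
    (ℕ.≤-reflexive (≡.cong toℕ (≡.sym (Fin.suc-injective (≡.trans eq (next-inject₁ (suc k)))))))

-- Determinant and eigenvectors of a weighted cycle

module CyclicMatrix {c ℓ} (R : CommutativeRing c ℓ) where
  open CommutativeRing R hiding (zero)
  open MatrixAlgebra rawRing
  open IntegerRingSolver R
  open Algebra.Properties.Semiring.Exp semiring using (_^_)
  open Algebra.Properties.CommutativeMonoid.Sum +-commutativeMonoid
    using (sum; sum-cong-≋; sum-replicate-zero; sum-remove; sum-init-last)
  open Algebra.Properties.CommutativeMonoid.Sum *-commutativeMonoid
    using () renaming (sum to product)
  open Relation.Binary.Reasoning.Setoid setoid

  sum-zero : ∀ {n} {f : Vector Carrier n} → (∀ i → f i ≈ 0#) → sum f ≈ 0#
  sum-zero {n} f≈0 = trans (sum-cong-≋ f≈0) (sum-replicate-zero n)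

  sum-single : ∀ {n} (f : Vector Carrier n) k → (∀ j → j ≢ k → f j ≈ 0#) → sum f ≈ f k
  sum-single {suc n} f k f≈0 = trans (sum-remove {i = k} f)
    (trans (+-congˡ (sum-zero λ j → f≈0 (punchIn k j) (Fin.punchInᵢ≢i k j))) (+-identityʳ _))

  sum-next : ∀ {n} (f : Vector Carrier n) → sum (f ∘ next) ≈ sum f
  sum-next {zero}  f = refl
  sum-next {suc n} f = begin
    sum (f ∘ next)                                     ≈⟨ sum-init-last (f ∘ next) ⟩
    sum (f ∘ next ∘ inject₁) + f (next (fromℕ n))      ≈⟨ +-cong (sum-cong-≋ λ i → reflexive
        (≡.cong f (next-inject₁ i))) (reflexive (≡.cong f (next-fromℕ n))) ⟩
    sum (f ∘ suc) + f zero                             ≈⟨ +-comm _ _ ⟩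
    sum f                                              ∎

  private
    0-term : ∀ s {x} d → x ≈ 0# → s * (x * d) ≈ 0#
    0-term s d x≈0 = trans (*-congˡ (trans (*-congʳ x≈0) (zeroˡ d))) (zeroʳ s)

    0-minor : ∀ s x {d} → d ≈ 0# → s * (x * d) ≈ 0#
    0-minor s x d≈0 = trans (*-congˡ (trans (*-congˡ d≈0) (zeroʳ x))) (zeroʳ s)

  -- Term 0 of the expansion contains an entry of column 0, and every other minor keeps that column,
  -- so induction applies.
  det-zeroColumn : ∀ {n} (M : Matrix Carrier (suc n)) → (∀ i → M i zero ≈ 0#) → det M ≈ 0#
  det-zeroColumn {n} M col≈0 = sum-zero (term n M col≈0)
    where
    term : ∀ n (M : Matrix Carrier (suc n)) → (∀ i → M i zero ≈ 0#) → (j : Fin (suc n)) →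
      (- 1#) ^ toℕ j * (M zero j * det (λ i k → M (suc i) (punchIn j k))) ≈ 0#
    term n       M col≈0 zero    = 0-term _ _ (col≈0 zero)
    term (suc n) M col≈0 (suc j) =
      0-minor _ _ (det-zeroColumn (λ i k → M (suc i) (punchIn (suc j) k)) (col≈0 ∘ suc))

  det-triangular : ∀ {n} (M : Matrix Carrier n) z → (∀ i → M i i ≈ z) →
    (∀ i j → toℕ j ℕ.< toℕ i → M i j ≈ 0#) → det M ≈ z ^ n
  det-triangular {zero}  M z diag lower = refl
  det-triangular {suc n} M z diag lower = begin
    det M                                ≈⟨ +-congˡ (sum-zero (term n M lower)) ⟩
    1# * (M zero zero * det (λ i k → M (suc i) (suc k))) + 0#
      ≈⟨ trans (+-identityʳ _) (*-identityˡ _) ⟩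
    M zero zero * det (λ i k → M (suc i) (suc k))
      ≈⟨ *-cong (diag zero) (det-triangular (λ i k → M (suc i) (suc k)) z (diag ∘ suc)
          (λ i j j<i → lower (suc i) (suc j) (s≤s j<i))) ⟩
    z * z ^ n                            ∎
    where
    term : ∀ n (M : Matrix Carrier (suc n)) → (∀ i j → toℕ j ℕ.< toℕ i → M i j ≈ 0#) → (j : Fin n) →
      (- 1#) ^ toℕ (suc j) * (M zero (suc j) * det (λ i k → M (suc i) (punchIn (suc j) k))) ≈ 0#
    term (suc n) M lower j =
      0-minor _ _ (det-zeroColumn (λ i k → M (suc i) (punchIn (suc j) k)) (λ i → lower (suc i) zero
          (s≤s z≤n)))

  -- The shape left by deleting row 0 and column 1 from zI − A; it is
  -- reproduced by another such deletion.
  det-cyclicMinor : ∀ {m} (N : Matrix Carrier (suc m)) (c : Vector Carrier (suc m)) →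
    (∀ i → N i (next i) ≈ - c i) → (∀ i → next i ≢ zero → N i zero ≈ 0#) →
    (∀ i j → suc (toℕ i) ℕ.< toℕ j → N i j ≈ 0#) → det N ≈ - product c
  det-cyclicMinor {zero} N c Nc N0 Nu = begin
    1# * (N zero zero * 1#) + 0# ≈⟨ +-congʳ (*-congˡ (*-congʳ (Nc zero))) ⟩
    1# * (- c zero * 1#) + 0#    ≈⟨ solve 1 (λ x → con (+ 1) :* (:- x :* con (+ 1)) :+ con (+ 0)
        := :- (x :* con (+ 1))) refl (c zero) ⟩
    - (c zero * 1#)              ∎
  det-cyclicMinor {suc m} N c Nc N0 Nu = begin
    det N ≈⟨ +-cong (0-term _ _ (N0 zero λ ())) (+-cong (*-congˡ (*-cong (Nc zero) ih))
               (sum-zero λ j → 0-term _ _ (Nu zero (suc (suc j)) (s≤s (s≤s z≤n))))) ⟩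
    0# + ((- 1# * 1#) * (- c zero * - product (c ∘ suc)) + 0#)
      ≈⟨ solve 2 (λ x y → con (+ 0) :+ ((:- con (+ 1) :* con (+ 1)) :* (:- x :* :- y) :+ con (+ 0))
          := :- (x :* y)) refl _ _ ⟩
    - (c zero * product (c ∘ suc)) ∎
    where
    N′ : Matrix Carrier (suc m)
    N′ i k = N (suc i) (punchIn (suc zero) k)
    upper : ∀ i j → suc (toℕ i) ℕ.< toℕ j → N′ i j ≈ 0#
    upper i (suc j) i<j = Nu (suc i) (suc (suc j)) (s≤s i<j)
    ih : det N′ ≈ - product (c ∘ suc)
    ih = det-cyclicMinor N′ (c ∘ suc)
      (λ i → trans (reflexive (≡.cong (N (suc i)) (punchIn₁-next i))) (Nc (suc i)))
      (λ i i≢ → N0 (suc i) λ eq → i≢ (Fin.punchIn-injective (suc zero) _ zero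
          (≡.trans (punchIn₁-next i) eq)))
      upper

  -- The sign of the product does not depend on the size: the cofactor sign of column 1 cancels the
  -- sign of `- c zero`, at this step and at each step inside the minor, so a single minus sign
  -- remains.
  det-cyclic : ∀ {m} (M : Matrix Carrier (suc (suc m))) z (c : Vector Carrier (suc (suc m))) →
    (∀ i → M i i ≈ z) → (∀ i → M i (next i) ≈ - c i) →
    (∀ i j → j ≢ i → j ≢ next i → M i j ≈ 0#) → det M ≈ z ^ suc (suc m) - product c
  det-cyclic {m} M z c diag Mc M0 = begin
    det M ≈⟨ +-cong (*-congˡ (*-cong (diag zero) triangular))
        (+-cong (*-congˡ (*-cong (Mc zero) cyclic))
               (sum-zero λ j → 0-term _ _ (M0 zero (suc (suc j)) (λ ()) (λ ())))) ⟩
    1# * (z * z ^ suc m) + ((- 1# * 1#) * (- c zero * - product (c ∘ suc)) + 0#)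
      ≈⟨ solve 4 (λ z w x y → con (+ 1) :* (z :* w) :+ ((:- con (+ 1) :* con (+ 1)) :*
          (:- x :* :- y) :+ con (+ 0)) := z :* w :- (x :* y)) refl _ _ _ _ ⟩
    z ^ suc (suc m) - product c ∎
    where
    triangular : det (λ i k → M (suc i) (suc k)) ≈ z ^ suc m
    triangular = det-triangular _ z (diag ∘ suc) λ i j j<i → M0 (suc i) (suc j)
      (λ eq → ℕ.<-irrefl (≡.cong toℕ (Fin.suc-injective eq)) j<i) (next-suc≢ i j j<i)
    N : Matrix Carrier (suc m)
    N i k = M (suc i) (punchIn (suc zero) k)
    upper : ∀ i j → suc (toℕ i) ℕ.< toℕ j → N i j ≈ 0#
    upper i j@(suc j′) i<j = M0 (suc i) (suc (suc j′))
      (λ eq → ℕ.<-irrefl (≡.cong toℕ (≡.sym (Fin.suc-injective eq))) (ℕ.<-trans (ℕ.n<1+n _) i<j))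
      (λ eq → ℕ.<-irrefl ≡.refl (ℕ.<-≤-trans i<j (ℕ.≤-trans
        (ℕ.≤-reflexive (≡.cong toℕ (Fin.punchIn-injective (suc zero) j (next i)
            (≡.trans eq (≡.sym (punchIn₁-next i))))))
        (toℕ-next≤ i))))
    cyclic : det N ≈ - product (c ∘ suc)
    cyclic = det-cyclicMinor N (c ∘ suc)
      (λ i → trans (reflexive (≡.cong (M (suc i)) (punchIn₁-next i))) (Mc (suc i)))
      (λ i i≢ → M0 (suc i) zero (λ ()) λ eq → i≢ (Fin.punchIn-injective (suc zero) _ zero
          (≡.trans (punchIn₁-next i) (≡.sym eq))))
      upper

  module _ {m} (M : Matrix Carrier (suc m)) (c : Vector Carrier (suc m))
    (Mc : ∀ i → M i (next i) ≈ c i) (M0 : ∀ i j → j ≢ next i → M i j ≈ 0#) where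

    cyclic-*ᵥ : ∀ v i → (M *ᵥ v) i ≈ c i * v (next i)
    cyclic-*ᵥ v i = trans
      (sum-single (λ j → M i j * v j) (next i) λ j j≢ → trans (*-congʳ (M0 i j j≢)) (zeroˡ _))
      (*-congʳ (Mc i))

  tailProduct : ∀ {n} → Vector Carrier n → Vector Carrier n
  tailProduct f zero    = product f
  tailProduct f (suc i) = tailProduct (f ∘ suc) i

  tailProduct-inject₁ : ∀ {n} (f : Vector Carrier (suc n)) i →
    tailProduct f (inject₁ i) ≈ f (inject₁ i) * tailProduct f (suc i)
  tailProduct-inject₁ {suc n} f zero    = refl
  tailProduct-inject₁ {suc n} f (suc i) = tailProduct-inject₁ (f ∘ suc) i

  tailProduct-fromℕ : ∀ n (f : Vector Carrier (suc n)) → tailProduct f (fromℕ n) ≈ f (fromℕ n)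
  tailProduct-fromℕ zero    f = *-identityʳ _
  tailProduct-fromℕ (suc n) f = tailProduct-fromℕ n (f ∘ suc)

  cyclicEigenvector : ∀ {n} → Vector Carrier n → Carrier → Vector Carrier n
  cyclicEigenvector c μ i = μ ^ toℕ i * tailProduct c i

  -- Inside the path, `c i` completes the tail product while the power of μ grows by one. The arc
  -- back to vertex 0 fits because μⁿ is the product of all the gains.
  cyclicEigenvector-next : ∀ {m} (c : Vector Carrier (suc m)) μ → μ ^ suc m ≈ product c → ∀ i →
    c i * cyclicEigenvector c μ (next i) ≈ μ * cyclicEigenvector c μ i
  cyclicEigenvector-next {m} c μ μ^n≈ i with view i
  ... | ‵fromℕ rewrite next-fromℕ m | Fin.toℕ-fromℕ m = begin
    c (fromℕ m) * (1# * product c)   ≈⟨ *-congˡ (*-congˡ (sym μ^n≈)) ⟩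
    c (fromℕ m) * (1# * (μ * μ ^ m)) ≈⟨ solve 3 (λ x μ w → x :* (con (+ 1) :* (μ :* w))
        := μ :* (w :* x)) refl _ _ _ ⟩
    μ * (μ ^ m * c (fromℕ m))        ≈⟨ *-congˡ (*-congˡ (tailProduct-fromℕ m c)) ⟨
    μ * (μ ^ m * tailProduct c (fromℕ m)) ∎
  ... | ‵inject₁ j rewrite next-inject₁ j | Fin.toℕ-inject₁ j = begin
    c (inject₁ j) * (μ * μ ^ toℕ j * tailProduct c (suc j))
      ≈⟨ solve 4 (λ x μ w t → x :* (μ :* w :* t) := μ :* (w :* (x :* t))) refl _ _ _ _ ⟩
    μ * (μ ^ toℕ j * (c (inject₁ j) * tailProduct c (suc j)))
      ≈⟨ *-congˡ (*-congˡ (tailProduct-inject₁ c j)) ⟨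
    μ * (μ ^ toℕ j * tailProduct c (inject₁ j)) ∎

-- Factorisation of monic polynomials

-- A monic polynomial of degree n is given by its n lower coefficients,
-- constant term first.
module MonicPolynomial {c ℓ} (R : CommutativeRing c ℓ) where
  open CommutativeRing R hiding (zero)
  open IntegerRingSolver R
  open Algebra.Properties.Semiring.Exp semiring using (_^_)
  open Algebra.Properties.CommutativeMonoid.Sum *-commutativeMonoid
    using () renaming (sum to product)
  open Relation.Binary.Reasoning.Setoid setoid

  eval : ∀ {n} → Vec Carrier n → Carrier → Carrier
  eval []       z = 1#
  eval (a ∷ as) z = a + z * eval as z

  -- Synthetic division by z - r: each coefficient of the quotient is the Horner value at r of the
  -- coefficients after it.
  quotient : ∀ {n} → Carrier → Vec Carrier (suc n) → Vec Carrier n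
  quotient {zero}  r (a ∷ [])       = []
  quotient {suc n} r (a ∷ as) = eval as r ∷ quotient r as

  eval-quotient : ∀ {n} r (p : Vec Carrier (suc n)) z →
    eval p z ≈ eval p r + (z - r) * eval (quotient r p) z
  eval-quotient {zero} r (a ∷ []) z =
    solve 3 (λ a r z → a :+ z :* con (+ 1) := (a :+ r :* con (+ 1)) :+ (z :- r) :* con (+ 1)) refl a r z
  eval-quotient {suc n} r (a ∷ as) z = begin
    a + z * eval as z ≈⟨ +-congˡ (*-congˡ (eval-quotient r as z)) ⟩
    a + z * (eval as r + (z - r) * eval (quotient r as) z)
      ≈⟨ solve 5 (λ a z r e q → a :+ z :* (e :+ (z :- r) :* q)
          := (a :+ r :* e) :+ (z :- r) :* (e :+ z :* q)) refl _ _ _ _ _ ⟩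
    (a + r * eval as r) + (z - r) * (eval as r + z * eval (quotient r as) z) ∎

  -- After one root is divided out, each of the others is still a root of the quotient, because its
  -- difference from the first can be cancelled.
  eval-roots : ∀ {n} (p : Vec Carrier n) (μ : Vector Carrier n) → (∀ i → eval p (μ i) ≈ 0#) →
    (∀ i j → i ≢ j → ∀ x → (μ i - μ j) * x ≈ 0# → x ≈ 0#) →
    ∀ z → eval p z ≈ product (λ i → z - μ i)
  eval-roots {zero}  []  μ root cancel z = refl
  eval-roots {suc n} p μ root cancel z = begin
    eval p z ≈⟨ eval-quotient (μ zero) p z ⟩
    eval p (μ zero) + (z - μ zero) * eval q z ≈⟨ +-congʳ (root zero) ⟩
    0# + (z - μ zero) * eval q z              ≈⟨ +-identityˡ _ ⟩
    (z - μ zero) * eval q z                   ≈⟨ *-congˡ (eval-roots q (μ ∘ suc) rootq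
        (λ i j i≢j → cancel (suc i) (suc j) (i≢j ∘ Fin.suc-injective)) z) ⟩
    (z - μ zero) * product (λ i → z - μ (suc i)) ∎
    where
    q = quotient (μ zero) p
    rootq : ∀ i → eval q (μ (suc i)) ≈ 0#
    rootq i = cancel (suc i) zero (λ ()) _ (begin
      (μ (suc i) - μ zero) * eval q (μ (suc i))                   ≈⟨ +-identityˡ _ ⟨
      0# + (μ (suc i) - μ zero) * eval q (μ (suc i))              ≈⟨ +-congʳ (root zero) ⟨
      eval p (μ zero) + (μ (suc i) - μ zero) * eval q (μ (suc i)) ≈⟨ eval-quotient (μ zero) p _ ⟨
      eval p (μ (suc i))                                          ≈⟨ root (suc i) ⟩
      0# ∎)

  eval-replicate-0 : ∀ n z → eval (replicate n 0#) z ≈ z ^ n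
  eval-replicate-0 zero    z = refl
  eval-replicate-0 (suc n) z = trans (+-identityˡ _) (*-congˡ (eval-replicate-0 n z))

  power-roots : ∀ {n} g (μ : Vector Carrier (suc n)) → (∀ i → μ i ^ suc n ≈ g) →
    (∀ i j → i ≢ j → ∀ x → (μ i - μ j) * x ≈ 0# → x ≈ 0#) →
    ∀ z → z ^ suc n - g ≈ product (λ i → z - μ i)
  power-roots {n} g μ root cancel z = trans (sym (eval-p z))
    (eval-roots p μ (λ i → trans (eval-p _) (trans (+-congʳ (root i)) (-‿inverseʳ g))) cancel z)
    where
    p = - g ∷ replicate n 0#
    eval-p : ∀ z → eval p z ≈ z ^ suc n - g
    eval-p z = trans (+-comm _ _) (+-congʳ (*-congˡ (eval-replicate-0 n z)))

-- Ordered field arithmetic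

module RealNumbers {c ℓ₁ ℓ₂} (ℝ : Reals c ℓ₁ ℓ₂) where
  open Reals ℝ public
  open IsHeytingField isHeytingField public
    using (isCommutativeRing; #⇒invertible; invertible⇒#; tight; #-cotrans)
  open IsStrictPartialOrder isStrictPartialOrder public
    using (<-resp-≈) renaming (trans to <-trans; irrefl to <-irrefl)

  commutativeRing : CommutativeRing c ℓ₁
  commutativeRing = record { isCommutativeRing = isCommutativeRing }

  open CommutativeRing commutativeRing public
    hiding (Carrier; _≈_; _+_; _*_; -_; 0#; 1#; zero; rawRing; isCommutativeRing)
  open Algebra.Properties.Semiring.Exp semiring public using (_^_)
  open Algebra.Apartness.Properties.HeytingCommutativeRing
    (HeytingField.heytingCommutativeRing heytingField) using (1#0)
  open IntegerRingSolver commutativeRing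
  open Relation.Binary.Reasoning.Setoid setoid

  opaque
    <-respʳ : ∀ {x y z} → y ≈ z → x < y → x < z
    <-respʳ = proj₁ <-resp-≈

    <-respˡ : ∀ {x y z} → y ≈ z → y < x → z < x
    <-respˡ = proj₂ <-resp-≈

    <-asym : ∀ {x y} → x < y → ¬ (y < x)
    <-asym x<y y<x = <-irrefl refl (<-trans x<y y<x)

    <-cotrans : ∀ {x y} z → x < y → x < z ⊎ z < y
    <-cotrans z x<y with #-cotrans (inj₁ x<y) z
    ... | inj₁ (inj₁ x<z) = inj₁ x<z
    ... | inj₁ (inj₂ z<x) = inj₂ (<-trans z<x x<y)
    ... | inj₂ (inj₁ z<y) = inj₂ z<y
    ... | inj₂ (inj₂ y<z) = inj₁ (<-trans x<y y<z)

    <⇒0< : ∀ {x y} → x < y → 0# < y - x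
    <⇒0< {x} x<y = <-respˡ (-‿inverseʳ x) (+-monoˡ-< (- x) x<y)

    0<⇒< : ∀ {x y} → 0# < y - x → x < y
    0<⇒< {x} {y} 0<y-x = <-respˡ (+-identityˡ x)
      (<-respʳ (solve 2 (λ x y → y :- x :+ x := y) refl x y) (+-monoˡ-< x 0<y-x))

    <0⇒0< : ∀ {x} → x < 0# → 0# < - x
    <0⇒0< x<0 = <-respʳ (+-identityˡ _) (<⇒0< x<0)

    0<-⇒<0 : ∀ {x} → 0# < - x → x < 0#
    0<-⇒<0 0<-x = 0<⇒< (<-respʳ (sym (+-identityˡ _)) 0<-x)

    0<⇒0≤ : ∀ {x} → 0# < x → 0# ≤ x
    0<⇒0≤ = <-asym

    0≤-resp : ∀ {x y} → x ≈ y → 0# ≤ x → 0# ≤ y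
    0≤-resp x≈y 0≤x y<0 = 0≤x (<-respˡ (sym x≈y) y<0)

    ≈⇒0≤ : ∀ {x} → x ≈ 0# → 0# ≤ x
    ≈⇒0≤ x≈0 x<0 = <-irrefl x≈0 x<0

    0≤⇒≤ : ∀ {x y} → 0# ≤ y - x → x ≤ y
    0≤⇒≤ {x} {y} 0≤y-x y<x = 0≤y-x (0<-⇒<0 (<-respʳ (solve 2 (λ x y → x :- y
        := :- (y :- x)) refl x y) (<⇒0< y<x)))

    0<-+ : ∀ {x y} → 0# < x → 0# ≤ y → 0# < x + y
    0<-+ {x} {y} 0<x 0≤y with <-cotrans (x + y) 0<x
    ... | inj₁ 0<x+y = 0<x+y
    ... | inj₂ x+y<x = ⊥-elim (0≤y (0<-⇒<0 (<-respʳ (solve 2 (λ x y → x :- (x :+ y)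
        := :- y) refl x y) (<⇒0< x+y<x))))

    0≤-+ : ∀ {x y} → 0# ≤ x → 0# ≤ y → 0# ≤ x + y
    0≤-+ {x} {y} 0≤x 0≤y x+y<0 = 0≤y (0<-⇒<0
      (<-respʳ (solve 2 (λ x y → :- (x :+ y) :+ x := :- y) refl x y) (0<-+ (<0⇒0< x+y<0) 0≤x)))

    0<-+⁻ : ∀ {x y} → 0# < x + y → 0# < x ⊎ 0# < y
    0<-+⁻ {x} {y} 0<x+y with <-cotrans x 0<x+y
    ... | inj₁ 0<x   = inj₁ 0<x
    ... | inj₂ x<x+y = inj₂ (<-respʳ (solve 2 (λ x y → x :+ y :- x := y) refl x y) (<⇒0< x<x+y))

    -- An inverse `z` of `x * y` makes `y * z` an inverse of `x`. This is the source of all sign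
    -- information about the factors of a product.
    *-#0 : ∀ {x y} → x * y # 0# → x # 0#
    *-#0 {x} {y} xy#0 with #⇒invertible xy#0
    ... | z , _ , xy*z≈1 = invertible⇒# (y * z ,
          trans (solve 3 (λ x y z → y :* z :* (x :- con (+ 0))
              := (x :* y :- con (+ 0)) :* z) refl x y z) xy*z≈1 ,
          trans (solve 3 (λ x y z → (x :- con (+ 0)) :* (y :* z)
              := (x :* y :- con (+ 0)) :* z) refl x y z) xy*z≈1)

    0≤∧#0⇒0< : ∀ {x} → 0# ≤ x → x # 0# → 0# < x
    0≤∧#0⇒0< 0≤x (inj₁ x<0) = ⊥-elim (0≤x x<0)
    0≤∧#0⇒0< 0≤x (inj₂ 0<x) = 0<x

    0<-*⁻ˡ : ∀ {x y} → 0# ≤ x → 0# < x * y → 0# < x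
    0<-*⁻ˡ 0≤x 0<xy = 0≤∧#0⇒0< 0≤x (*-#0 (inj₂ 0<xy))

    -- A weak inequality is a negation, so x y < 0 may be assumed. Then both factors are apart from
    -- 0, hence positive, and so is their product.
    0≤-* : ∀ {x y} → 0# ≤ x → 0# ≤ y → 0# ≤ x * y
    0≤-* {x} {y} 0≤x 0≤y xy<0 = <-asym xy<0
      (*-pos (0≤∧#0⇒0< 0≤x (*-#0 (inj₁ xy<0)))
             (0≤∧#0⇒0< 0≤y (*-#0 (inj₁ (<-respˡ (*-comm x y) xy<0)))))

    0<-*⁻ʳ : ∀ {x y} → 0# ≤ x → 0# < x * y → 0# < y
    0<-*⁻ʳ {x} {y} 0≤x 0<xy with *-#0 (inj₂ (<-respʳ (*-comm x y) 0<xy))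
    ... | inj₂ 0<y = 0<y
    ... | inj₁ y<0 = ⊥-elim (0≤-* 0≤x (0<⇒0≤ (<0⇒0< y<0))
      (0<-⇒<0 (<-respʳ (solve 2 (λ x y → x :* y := :- (x :* :- y)) refl x y) 0<xy)))

    0≤-*⁻ : ∀ {x y} → 0# < x → 0# ≤ x * y → 0# ≤ y
    0≤-*⁻ {x} {y} 0<x 0≤xy y<0 = 0≤xy (0<-⇒<0
      (<-respʳ (solve 2 (λ x y → x :* :- y := :- (x :* y)) refl x y) (*-pos 0<x (<0⇒0< y<0))))

    ≤-antisym : ∀ {x y} → 0# ≤ x - y → 0# ≤ y - x → x ≈ y
    ≤-antisym 0≤x-y 0≤y-x = proj₁ (tight _ _) [ 0≤⇒≤ 0≤x-y , 0≤⇒≤ 0≤y-x ]′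

    square-≥0 : ∀ x → 0# ≤ x * x
    square-≥0 x xx<0 with *-#0 (inj₁ xx<0)
    ... | inj₁ x<0 = <-asym xx<0 (<-respʳ (solve 1 (λ x → :- x :* :- x
        := x :* x) refl x) (*-pos (<0⇒0< x<0) (<0⇒0< x<0)))
    ... | inj₂ 0<x = <-asym xx<0 (*-pos 0<x 0<x)

    square-pos : ∀ {x} → x # 0# → 0# < x * x
    square-pos {x} (inj₁ x<0) = <-respʳ (solve 1 (λ x → :- x :* :- x
        := x :* x) refl x) (*-pos (<0⇒0< x<0) (<0⇒0< x<0))
    square-pos (inj₂ 0<x) = *-pos 0<x 0<x

  opaque
    0<1 : 0# < 1#
    0<1 = <-respʳ (*-identityˡ 1#) (square-pos 1#0)

    0≤1 : 0# ≤ 1#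
    0≤1 = 0<⇒0≤ 0<1

    0<2 : 0# < 1# + 1#
    0<2 = 0<-+ 0<1 0≤1

    0≤3 : 0# ≤ 1# + 1# + 1#
    0≤3 = 0<⇒0≤ (0<-+ 0<2 0≤1)

    0≤-halve : ∀ {x} → 0# ≤ x + x → 0# ≤ x
    0≤-halve {x} 0≤x+x = 0≤-*⁻ 0<2 (0≤-resp (solve 1 (λ x → x :+ x := con (+ 2) :* x) refl x) 0≤x+x)

    reciprocal : ∀ {x} → 0# < x → ∃[ y ] (x * y ≈ 1# × 0# < y)
    reciprocal {x} 0<x with #⇒invertible (inj₂ 0<x)
    ... | y , _ , x*y≈1 = y , x*y≈1′ , 0<-*⁻ʳ (0<⇒0≤ 0<x) (<-respʳ (sym x*y≈1′) 0<1)
      where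
      x*y≈1′ : x * y ≈ 1#
      x*y≈1′ = trans (solve 2 (λ x y → x :* y := (x :- con (+ 0)) :* y) refl x y) x*y≈1

    *-cancel : ∀ {x y} → 0# < x → x * y ≈ 0# → y ≈ 0#
    *-cancel {x} {y} 0<x xy≈0 with reciprocal 0<x
    ... | z , xz≈1 , _ = begin
      y           ≈⟨ *-identityˡ y ⟨
      1# * y      ≈⟨ *-congʳ xz≈1 ⟨
      x * z * y   ≈⟨ solve 3 (λ x y z → x :* z :* y := x :* y :* z) refl x y z ⟩
      x * y * z   ≈⟨ *-congʳ xy≈0 ⟩
      0# * z      ≈⟨ zeroˡ z ⟩
      0#          ∎

    -- The device for using an equation `e ≈ 0` together with the solver: the polynomial identity is
    -- stated with a suitable multiple of `e` added, and that multiple is then dropped.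
    drop-0 : ∀ {e} x t → e ≈ 0# → x + t * e ≈ x
    drop-0 x t e≈0 = trans (+-congˡ (trans (*-congˡ e≈0) (zeroʳ t))) (+-identityʳ x)

    -≈0 : ∀ {x y} → x ≈ y → x - y ≈ 0#
    -≈0 {x} {y} x≈y = trans (+-congʳ x≈y) (-‿inverseʳ y)

    ½ : Carrier
    ½ = proj₁ (reciprocal 0<2)

    0<½ : 0# < ½
    0<½ = proj₂ (proj₂ (reciprocal 0<2))

    ½+½≈1 : ½ + ½ ≈ 1#
    ½+½≈1 = trans (solve 1 (λ h → h :+ h := con (+ 2) :* h) refl ½) (proj₁ (proj₂ (reciprocal 0<2)))

  -- This is 3/4, the contraction factor of the square root iteration below; it also exceeds 1/√2,
  -- the largest factor by which a bisection in the right half circle shrinks the imaginary part.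
  q : Carrier
  q = 1# - ½ * ½

  opaque
    4¼-1≈0 : (½ + ½) * (½ + ½) - 1# ≈ 0#
    4¼-1≈0 = -≈0 (trans (*-cong ½+½≈1 ½+½≈1) (*-identityˡ 1#))

    0≤q : 0# ≤ q
    0≤q = 0≤-resp
      (trans (solve 1 (λ h → con (+ 3) :* (h :* h)
          := (con (+ 1) :- h :* h) :+ con (+ 1) :* ((h :+ h) :* (h :+ h) :- con (+ 1))) refl ½)
             (drop-0 q 1# 4¼-1≈0))
      (0≤-* 0≤3 (square-≥0 ½))

    0≤^ : ∀ {x} → 0# ≤ x → ∀ k → 0# ≤ x ^ k
    0≤^ 0≤x zero    = 0≤1
    0≤^ 0≤x (suc k) = 0≤-* 0≤x (0≤^ 0≤x k)

    0≤q^ : ∀ k → 0# ≤ q ^ k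
    0≤q^ = 0≤^ 0≤q

    q^≤1 : ∀ k → 0# ≤ 1# - q ^ k
    q^≤1 zero    = ≈⇒0≤ (-‿inverseʳ 1#)
    q^≤1 (suc k) = 0≤-resp
      (solve 2 (λ h Q → (con (+ 1) :- Q) :+ h :* h :* Q
          := con (+ 1) :- (con (+ 1) :- h :* h) :* Q) refl ½ (q ^ k))
      (0≤-+ (q^≤1 k) (0≤-* (square-≥0 ½) (0≤q^ k)))

    0≤·1 : ∀ k → 0# ≤ k · 1#
    0≤·1 zero    = ≈⇒0≤ refl
    0≤·1 (suc k) = 0≤-+ 0≤1 (0≤·1 k)

    -- A polynomial rate for qᵏ that the Archimedean axiom can use. The induction step needs (3/4)(k
    -- + 4) ≤ k + 3, and 3 is the least shift for which this holds at k = 0.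
    k*q^k≤3 : ∀ k → 0# ≤ (1# + 1# + 1#) - (k · 1# + (1# + 1# + 1#)) * q ^ k
    k*q^k≤3 zero    = ≈⇒0≤ (solve 0 (con (+ 3) :- (con (+ 0) :+ con (+ 3)) :* con (+ 1)
        := con (+ 0)) refl)
    k*q^k≤3 (suc k) = 0≤-resp
      (sym (trans (solve 3 (λ κ h Q → con (+ 3) :- (con (+ 1) :+ κ :+ con (+ 3)) :*
          ((con (+ 1) :- h :* h) :* Q)
          := (con (+ 3) :- (κ :+ con (+ 3)) :* Q) :+ κ :* (h :* h) :* Q :+ Q :*
              ((h :+ h) :* (h :+ h) :- con (+ 1))) refl (k · 1#) ½ (q ^ k))
        (drop-0 _ _ 4¼-1≈0)))
      (0≤-+ (k*q^k≤3 k) (0≤-* (0≤-* (0≤·1 k) (square-≥0 ½)) (0≤q^ k)))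

    -- For k above 3C/ε, the bound (k + 3) qᵏ ≤ 3 gives k C qᵏ ≤ 3C < k ε, and the factor k is
    -- cancelled.
    q^-small : ∀ {C ε} → 0# ≤ C → 0# < ε → ∃[ k ] (0# < ε - C * q ^ k)
    q^-small {C} {ε} 0≤C 0<ε with reciprocal 0<ε
    ... | δ , εδ≈1 , 0<δ with archimedean ((1# + 1# + 1#) * C * δ)
    ...   | k , 3Cδ<k = k , 0<-*⁻ʳ (0≤·1 k) (<-respʳ eq
              (0<-+ (0<-+ (*-pos 0<ε (<⇒0< 3Cδ<k)) (0≤-* 0≤C (k*q^k≤3 k)))
                    (0≤-* (0≤-* 0≤3 0≤C) (0≤q^ k))))
      where
      eq : ε * (k · 1# - (1# + 1# + 1#) * C * δ)
             + C * ((1# + 1# + 1#) - (k · 1# + (1# + 1# + 1#)) * q ^ k) + (1# + 1# + 1#) * C * q ^ k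
           ≈ k · 1# * (ε - C * q ^ k)
      eq = begin
        _ ≈⟨ solve 5 (λ e κ C d Q → e :* (κ :- con (+ 3) :* C :* d) :+ C :*
            (con (+ 3) :- (κ :+ con (+ 3)) :* Q) :+ con (+ 3) :* C :* Q
               := κ :* (e :- C :* Q) :+ con (+ 3) :* C :* (con (+ 1) :- e :* d)) refl ε (k · 1#) C δ
                   (q ^ k) ⟩
        k · 1# * (ε - C * q ^ k) + (1# + 1# + 1#) * C * (1# - ε * δ)
          ≈⟨ drop-0 _ _ (-≈0 (sym εδ≈1)) ⟩
        k · 1# * (ε - C * q ^ k) ∎

  -- Bounds on absolute values

  infix 4 _⊑_
  _⊑_ : Carrier → Carrier → Set ℓ₂
  a ⊑ b = 0# ≤ b - a × 0# ≤ b + a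

  opaque
    ⊑-resp : ∀ {a a′ b b′} → a ≈ a′ → b ≈ b′ → a ⊑ b → a′ ⊑ b′
    ⊑-resp a≈ b≈ (l , u) = 0≤-resp (+-cong b≈ (-‿cong a≈)) l , 0≤-resp (+-cong b≈ a≈) u

    ⊑⇒0≤ : ∀ {a b} → a ⊑ b → 0# ≤ b
    ⊑⇒0≤ {a} {b} (l , u) = 0≤-halve (0≤-resp (solve 2 (λ a b → b :- a :+ (b :+ a)
        := b :+ b) refl a b) (0≤-+ l u))

    ⊑-≤ : ∀ {a b b′} → a ⊑ b → 0# ≤ b′ - b → a ⊑ b′
    ⊑-≤ {a} {b} {b′} (l , u) b≤b′ =
      0≤-resp (solve 3 (λ a b c → b :- a :+ (c :- b) := c :- a) refl a b b′) (0≤-+ l b≤b′) ,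
      0≤-resp (solve 3 (λ a b c → b :+ a :+ (c :- b) := c :+ a) refl a b b′) (0≤-+ u b≤b′)

    ⊑-+ : ∀ {a b a′ b′} → a ⊑ b → a′ ⊑ b′ → a + a′ ⊑ b + b′
    ⊑-+ {a} {b} {a′} {b′} (l , u) (l′ , u′) =
      0≤-resp (solve 4 (λ a b c d → (b :- a) :+ (d :- c)
          := b :+ d :- (a :+ c)) refl a b a′ b′) (0≤-+ l l′) ,
      0≤-resp (solve 4 (λ a b c d → (b :+ a) :+ (d :+ c)
          := b :+ d :+ (a :+ c)) refl a b a′ b′) (0≤-+ u u′)

    ⊑-neg : ∀ {a b} → a ⊑ b → - a ⊑ b
    ⊑-neg {a} {b} (l , u) = 0≤-resp (solve 2 (λ a b → b :+ a := b :- (:- a)) refl a b) u , l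

    -- Signs cannot be distinguished, but 2(bd - ac) = (b - a)(d + c) + (b + a)(d - c) is a sum of
    -- products of nonnegative factors, and similarly for bd + ac.
    ⊑-* : ∀ {a b a′ b′} → a ⊑ b → a′ ⊑ b′ → a * a′ ⊑ b * b′
    ⊑-* {a} {b} {a′} {b′} (l , u) (l′ , u′) =
      0≤-halve (0≤-resp (solve 4 (λ a b c d → (b :- a) :* (d :+ c) :+ (b :+ a) :* (d :- c)
          := (b :* d :- a :* c) :+ (b :* d :- a :* c)) refl a b a′ b′)
        (0≤-+ (0≤-* l u′) (0≤-* u l′))) ,
      0≤-halve (0≤-resp (solve 4 (λ a b c d → (b :- a) :* (d :- c) :+ (b :+ a) :* (d :+ c)
          := (b :* d :+ a :* c) :+ (b :* d :+ a :* c)) refl a b a′ b′)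
        (0≤-+ (0≤-* l l′) (0≤-* u u′)))

    0≤⇒⊑ : ∀ {a} → 0# ≤ a → a ⊑ a
    0≤⇒⊑ {a} 0≤a = ≈⇒0≤ (-‿inverseʳ a) , 0≤-+ 0≤a 0≤a

    ⊑-bound : ∀ a → a ⊑ 1# + a * a
    ⊑-bound a =
      0≤-halve (0≤-resp (solve 1 (λ a → con (+ 1) :+ a :* a :+ (a :- con (+ 1)) :* (a :- con (+ 1))
          := (con (+ 1) :+ a :* a :- a) :+ (con (+ 1) :+ a :* a :- a)) refl a)
        (0≤-+ (0≤-+ 0≤1 (square-≥0 a)) (square-≥0 (a - 1#)))) ,
      0≤-halve (0≤-resp (solve 1 (λ a → con (+ 1) :+ a :* a :+ (a :+ con (+ 1)) :* (a :+ con (+ 1))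
          := (con (+ 1) :+ a :* a :+ a) :+ (con (+ 1) :+ a :* a :+ a)) refl a)
        (0≤-+ (0≤-+ 0≤1 (square-≥0 a)) (square-≥0 (a + 1#))))

    square-≤⇒≤ : ∀ {a b} → 0# ≤ b → 0# ≤ b * b - a * a → 0# ≤ b - a
    square-≤⇒≤ {a} {b} 0≤b aa≤bb b-a<0 = aa≤bb (0<-⇒<0
      (<-respʳ (solve 2 (λ a b → (:- (b :- a)) :* ((:- (b :- a)) :+ (b :+ b))
          := :- (b :* b :- a :* a)) refl a b)
        (*-pos 0<a-b (0<-+ 0<a-b (0≤-+ 0≤b 0≤b)))))
      where
      0<a-b : 0# < - (b - a)
      0<a-b = <0⇒0< b-a<0

    square-≤⇒⊑ : ∀ {a b} → 0# ≤ b → 0# ≤ b * b - a * a → a ⊑ b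
    square-≤⇒⊑ {a} {b} 0≤b aa≤bb = square-≤⇒≤ 0≤b aa≤bb ,
      0≤-resp (+-congˡ (-‿involutive a)) (square-≤⇒≤ {a = - a} 0≤b
        (0≤-resp (solve 2 (λ a b → b :* b :- a :* a := b :* b :- (:- a) :* (:- a)) refl a b) aa≤bb))
      where open Algebra.Properties.Ring ring using (-‿involutive)

  -- Limits at a geometric rate

  -- Convergence to 0 at the rate of a fixed geometric sequence: all limits
  -- taken below have this rate, and no ε is needed to handle them.
  Small : (ℕ → Carrier) → Set (c ⊔ ℓ₂)
  Small f = ∃[ B ] (∀ k → f k ⊑ B * q ^ k)

  infix 4 _⟶_
  _⟶_ : (ℕ → Carrier) → Carrier → Set (c ⊔ ℓ₂)
  x ⟶ l = Small (λ k → x k - l)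

  opaque
    Small-resp : ∀ {f g} → (∀ k → f k ≈ g k) → Small f → Small g
    Small-resp f≈g (B , f⊑) = B , λ k → ⊑-resp (f≈g k) refl (f⊑ k)

    Small-+ : ∀ {f g} → Small f → Small g → Small (λ k → f k + g k)
    Small-+ (B , f⊑) (C , g⊑) = B + C , λ k → ⊑-resp refl (sym (distribʳ (q ^ k) B C))
        (⊑-+ (f⊑ k) (g⊑ k))

    Small-neg : ∀ {f} → Small f → Small (λ k → - f k)
    Small-neg (B , f⊑) = B , λ k → ⊑-neg (f⊑ k)

    Small-bounded : ∀ {f} → Small f → ∃[ B ] (∀ k → f k ⊑ B)
    Small-bounded (B , f⊑) = B , λ k → ⊑-≤ (f⊑ k) (0≤-resp
      (solve 2 (λ B Q → B :* (con (+ 1) :- Q) := B :- B :* Q) refl B (q ^ k))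
      (0≤-* (0≤-resp (*-identityʳ B) (⊑⇒0≤ (f⊑ 0))) (q^≤1 k)))

    Small-* : ∀ {f g : ℕ → Carrier} {B} → (∀ k → f k ⊑ B) → Small g → Small (λ k → f k * g k)
    Small-* {B = B} f⊑ (C , g⊑) = B * C , λ k → ⊑-resp refl (sym (*-assoc B C (q ^ k)))
        (⊑-* (f⊑ k) (g⊑ k))

    ⟶-resp : ∀ {x y l m} → (∀ k → x k ≈ y k) → l ≈ m → x ⟶ l → y ⟶ m
    ⟶-resp x≈y l≈m = Small-resp (λ k → +-cong (x≈y k) (-‿cong l≈m))

    ⟶-const : ∀ l → (λ _ → l) ⟶ l
    ⟶-const l = 0# , λ k → ⊑-resp (sym (-‿inverseʳ l)) (sym (zeroˡ (q ^ k))) (0≤⇒⊑ (≈⇒0≤ refl))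

    ⟶-+ : ∀ {x y l m} → x ⟶ l → y ⟶ m → (λ k → x k + y k) ⟶ l + m
    ⟶-+ {x} {y} {l} {m} x⟶l y⟶m = Small-resp
      (λ k → solve 4 (λ x y l m → x :- l :+ (y :- m) := x :+ y :- (l :+ m)) refl (x k) (y k) l m)
      (Small-+ x⟶l y⟶m)

    ⟶-neg : ∀ {x l} → x ⟶ l → (λ k → - x k) ⟶ - l
    ⟶-neg {x} {l} x⟶l = Small-resp {f = λ k → - (x k - l)}
      (λ k → solve 2 (λ x l → :- (x :- l) := :- x :- (:- l)) refl (x k) l) (Small-neg x⟶l)

    ⟶-bounded : ∀ {x l} → x ⟶ l → ∃[ B ] (∀ k → x k ⊑ B)
    ⟶-bounded {x} {l} x⟶l with Small-bounded x⟶l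
    ... | B , x-l⊑B = B + (1# + l * l) , λ k →
      ⊑-resp (solve 2 (λ x l → x :- l :+ l := x) refl (x k) l) refl (⊑-+ (x-l⊑B k) (⊑-bound l))

    ⟶-* : ∀ {x y l m} → x ⟶ l → y ⟶ m → (λ k → x k * y k) ⟶ l * m
    ⟶-* {x} {y} {l} {m} x⟶l y⟶m = Small-resp
      (λ k → solve 4 (λ x y l m → x :* (y :- m) :+ m :* (x :- l)
          := x :* y :- l :* m) refl (x k) (y k) l m)
      (Small-+ (Small-* {f = x} (proj₂ (⟶-bounded x⟶l)) y⟶m) (Small-* {f = λ _ → m}
          (λ _ → ⊑-bound m) x⟶l))

    ≤-geometric⇒≤0 : ∀ {a B} → 0# ≤ B → (∀ k → 0# ≤ B * q ^ k - a) → 0# ≤ - a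
    ≤-geometric⇒≤0 {a} {B} 0≤B a≤ -a<0 = absurd (q^-small 0≤B (<0⇒0< -a<0))
      where
      absurd : ¬ (∃[ k ] (0# < - (- a) - B * q ^ k))
      absurd (k , 0<a-Bq^k) = a≤ k (0<-⇒<0 (<-respʳ
        (solve 2 (λ a b → :- (:- a) :- b := :- (b :- a)) refl a (B * q ^ k)) 0<a-Bq^k))

    Small-const⇒≈0 : ∀ {a} → Small (λ _ → a) → a ≈ 0#
    Small-const⇒≈0 {a} (B , a⊑) = ≤-antisym {a} {0#}
      (0≤-resp (solve 1 (λ a → :- (:- a)
          := a :- con (+ 0)) refl a) (≤-geometric⇒≤0 0≤B (λ k → proj₁ (⊑-neg (a⊑ k)))))
      (0≤-resp (solve 1 (λ a → :- a := con (+ 0) :- a) refl a) (≤-geometric⇒≤0 0≤B (λ k →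
          proj₁ (a⊑ k))))
      where
      0≤B : 0# ≤ B
      0≤B = 0≤-resp (*-identityʳ B) (⊑⇒0≤ (a⊑ 0))

    ⟶-unique : ∀ {x l m} → x ⟶ l → x ⟶ m → l ≈ m
    ⟶-unique {x} {l} {m} x⟶l x⟶m = begin
      l           ≈⟨ solve 2 (λ l m → l := (l :- m) :+ m) refl l m ⟩
      (l - m) + m ≈⟨ +-congʳ (Small-const⇒≈0 (Small-resp
        (λ k → solve 3 (λ x l m → (x :- m) :+ (:- (x :- l))
            := l :- m) refl (x k) l m) (Small-+ x⟶m (Small-neg x⟶l)))) ⟩
      0# + m      ≈⟨ +-identityˡ m ⟩
      m           ∎

    ⟶-≥0 : ∀ {x l} → (∀ k → 0# ≤ x k) → x ⟶ l → 0# ≤ l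
    ⟶-≥0 {x} {l} 0≤x (B , x-l⊑) = 0≤-resp (solve 1 (λ l → :- (:- l) := l) refl l)
      (≤-geometric⇒≤0 (0≤-resp (*-identityʳ B) (⊑⇒0≤ (x-l⊑ 0))) λ k →
        0≤-resp (solve 3 (λ x l b → b :- (x :- l) :+ x := b :- (:- l)) refl (x k) l (B * q ^ k))
          (0≤-+ (proj₁ (x-l⊑ k)) (0≤x k)))

  module _ (x : ℕ → Carrier) (B : Carrier) (step : ∀ k → x (suc k) - x k ⊑ B * q ^ k) where
    private
      4# : Carrier
      4# = 1# + 1# + 1# + 1#

      opaque
        0≤B : 0# ≤ B
        0≤B = 0≤-resp (*-identityʳ B) (⊑⇒0≤ (step 0))

        0≤4B : 0# ≤ 4# * B
        0≤4B = 0≤-* (0≤-+ 0≤3 0≤1) 0≤B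

        -- 4 B qᵏ is the sum of the geometric series B qᵏ + B qᵏ⁺¹ + ….
        increment : ∀ k j → x (j ℕ.+ k) - x k ⊑ 4# * B * (q ^ k - q ^ (j ℕ.+ k))
        increment k zero = ⊑-resp (sym (-‿inverseʳ (x k)))
          (sym (trans (*-congˡ (-‿inverseʳ (q ^ k))) (zeroʳ _))) (0≤⇒⊑ (≈⇒0≤ refl))
        increment k (suc j) = ⊑-resp
          (solve 3 (λ a b c → (a :- b) :+ (b :- c)
              := a :- c) refl (x (suc j ℕ.+ k)) (x (j ℕ.+ k)) (x k))
          (sym (trans (solve 4 (λ B h Q P → con (+ 4) :* B :* (P :- (con (+ 1) :- h :* h) :* Q)
              := B :* Q :+ con (+ 4) :* B :* (P :- Q) :+ B :* Q :*
                  ((h :+ h) :* (h :+ h) :- con (+ 1))) refl B ½ (q ^ (j ℕ.+ k)) (q ^ k))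
            (drop-0 _ _ 4¼-1≈0)))
          (⊑-+ (step (j ℕ.+ k)) (increment k j))

        tail : ∀ {k n} → k ℕ.≤ n → x n - x k ⊑ 4# * B * q ^ k
        tail {k} {n} k≤n = ≡.subst (λ n → x n - x k ⊑ 4# * B * q ^ k) (ℕ.m∸n+n≡m k≤n)
          (⊑-≤ (increment k (n ℕ.∸ k)) (0≤-resp
            (solve 3 (λ B P Q → B :* Q := B :* P :- B :* (P :- Q))
                refl (4# * B) (q ^ k) (q ^ (n ℕ.∸ k ℕ.+ k)))
            (0≤-* 0≤4B (0≤q^ (n ℕ.∸ k ℕ.+ k)))))

        cauchy : Cauchy x
        -- Both `x m` and `x n` lie within 4 B qᴺ of `x N`, hence the doubled constant.
        cauchy ε 0<ε with q^-small (0≤-+ 0≤4B 0≤4B) 0<ε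
        ... | N , 0<ε-8Bq^N = N , λ m n N≤m N≤n → 0<⇒< (<-respʳ
          (solve 6 (λ e B Q xm xn xN → e :- (B :+ B) :* Q :+ ((B :* Q :- (xm :- xN)) :+
              (B :* Q :+ (xn :- xN))) := xn :+ e :- xm) refl ε (4# * B) (q ^ N) (x m) (x n) (x N))
          (0<-+ 0<ε-8Bq^N (0≤-+ (proj₁ (tail N≤m)) (proj₂ (tail N≤n)))))

    opaque
      -- `complete` says nothing about the rate. If the bound at k failed by some δ > 0, a term
      -- beyond k within δ of the limit would contradict `tail`.
      geometric-converges : ∃[ l ] (x ⟶ l)
      geometric-converges with complete x cauchy
      ... | l , x→l = l , 4# * B , λ k → lower k , upper k
        where
        lower : ∀ k → 0# ≤ 4# * B * q ^ k - (x k - l)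
        lower k neg with x→l _ (<0⇒0< neg)
        ... | N , near with near (N ℕ.⊔ k) (ℕ.m≤m⊔n N k)
        ...   | xn<l+δ , _ = proj₂ (tail (ℕ.m≤n⊔m N k)) (0<-⇒<0 (<-respʳ
          (solve 4 (λ b xk l xn → l :+ (:- (b :- (xk :- l))) :- xn
              := :- (b :+ (xn :- xk))) refl (4# * B * q ^ k) (x k) l (x (N ℕ.⊔ k)))
          (<⇒0< xn<l+δ)))
        upper : ∀ k → 0# ≤ 4# * B * q ^ k + (x k - l)
        upper k neg with x→l _ (<0⇒0< neg)
        ... | N , near with near (N ℕ.⊔ k) (ℕ.m≤m⊔n N k)
        ...   | _ , l<xn+δ = proj₁ (tail (ℕ.m≤n⊔m N k)) (0<-⇒<0 (<-respʳ
          (solve 4 (λ b xk l xn → xn :+ (:- (b :+ (xk :- l))) :- l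
              := :- (b :- (xn :- xk))) refl (4# * B * q ^ k) (x k) l (x (N ℕ.⊔ k)))
          (<⇒0< l<xn+δ)))

-- Square roots on the interval from 1/4 to 1

module RealSquareRoot {c ℓ₁ ℓ₂} (ℝ : Reals c ℓ₁ ℓ₂) where
  open RealNumbers ℝ
  open IntegerRingSolver commutativeRing

  opaque
    ½+½-1≈0 : ½ + ½ - 1# ≈ 0#
    ½+½-1≈0 = -≈0 ½+½≈1

  module _ (x : Carrier) (x≥¼ : 0# ≤ x - ½ * ½) (x≤1 : 0# ≤ 1# - x) where

    -- The iteration y ↦ y - (y² - x)/2 from 1 decreases to √x.
    record Approximation (k : ℕ) : Set (c ⊔ ℓ₂) where
      field
        y    : Carrier
        y≥½  : 0# ≤ y - ½
        y≤1  : 0# ≤ 1# - y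
        y²≥x : 0# ≤ y * y - x
        rate : 0# ≤ q ^ k - (y * y - x)
    open Approximation

    opaque
      refine-≥½ : ∀ {y} → 0# ≤ y - ½ → 0# ≤ 1# - y → 0# ≤ (y - ½ * (y * y - x)) - ½
      refine-≥½ {y} y≥½ y≤1 = 0≤-resp
        (sym (trans (solve 3 (λ h x y → (y :- h :* (y :* y :- x)) :- h
              := ((y :- h) :* (h :* (con (+ 1) :- y) :+ h :* h) :+ h :* (x :- h :* h)) :+
                  (:- ((y :- h) :* (con (+ 1) :+ h))) :* (h :+ h :- con (+ 1))) refl ½ x y)
          (drop-0 _ _ ½+½-1≈0)))
        (0≤-+ (0≤-* y≥½ (0≤-+ (0≤-* (0<⇒0≤ 0<½) y≤1) (square-≥0 ½))) (0≤-* (0<⇒0≤ 0<½) x≥¼))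

      refine-≤1 : ∀ {y} → 0# ≤ 1# - y → 0# ≤ y * y - x → 0# ≤ 1# - (y - ½ * (y * y - x))
      refine-≤1 {y} y≤1 y²≥x = 0≤-resp
        (solve 3 (λ h x y → con (+ 1) :- y :+ h :* (y :* y :- x)
            := con (+ 1) :- (y :- h :* (y :* y :- x))) refl ½ x y)
        (0≤-+ y≤1 (0≤-* (0<⇒0≤ 0<½) y²≥x))

      refine-square : ∀ {y} → 0# ≤ 1# - y → 0# ≤ y * y - x →
        0# ≤ (y - ½ * (y * y - x)) * (y - ½ * (y * y - x)) - x
      refine-square {y} y≤1 y²≥x = 0≤-resp
        (sym (trans (solve 3 (λ h x y → (y :- h :* (y :* y :- x)) :* (y :- h :* (y :* y :- x)) :- x
              := (y :* y :- x) :* ((h :+ h) :* (con (+ 1) :- y) :+ h :* h :* (y :* y :- x)) :+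
                  (:- (y :* y :- x)) :* (h :+ h :- con (+ 1))) refl ½ x y)
          (drop-0 _ _ ½+½-1≈0)))
        (0≤-* y²≥x (0≤-+ (0≤-* (0≤-+ (0<⇒0≤ 0<½) (0<⇒0≤ 0<½)) y≤1) (0≤-* (square-≥0 ½) y²≥x)))

      -- For e = y² - x the new error is e (1 - y + e/4); from y ≥ 1/2 and e ≤ qᵏ ≤ 1 the factor is
      -- at most 3/4.
      refine-rate : ∀ k {y} → 0# ≤ y - ½ → 0# ≤ y * y - x → 0# ≤ q ^ k - (y * y - x) →
        0# ≤ q ^ suc k - ((y - ½ * (y * y - x)) * (y - ½ * (y * y - x)) - x)
      refine-rate k {y} y≥½ y²≥x rate = 0≤-resp
        (solve 4 (λ h x y Q → (con (+ 1) :- h :* h) :* (Q :- (y :* y :- x))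
            :+ (y :* y :- x) :* ((h :+ h) :* (y :- h) :+ h :* h :* ((con (+ 1) :- Q) :+
                (Q :- (y :* y :- x))))
          := (con (+ 1) :- h :* h) :* Q :- ((y :- h :* (y :* y :- x)) :*
              (y :- h :* (y :* y :- x)) :- x)) refl ½ x y (q ^ k))
        (0≤-+ (0≤-* 0≤q rate) (0≤-* y²≥x (0≤-+ (0≤-* (0≤-+ (0<⇒0≤ 0<½) (0<⇒0≤ 0<½)) y≥½)
          (0≤-* (square-≥0 ½) (0≤-+ (q^≤1 k) rate)))))

      1-½≥0 : 0# ≤ 1# - ½
      1-½≥0 = 0≤-resp (trans (solve 1 (λ h → h := con (+ 1) :- h :+ con (+ 1) :* (h :+ h :- con (+ 1)))
          refl ½) (drop-0 _ _ ½+½-1≈0)) (0<⇒0≤ 0<½)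

    approximation : ∀ k → Approximation k
    approximation zero = record
      { y = 1# ; y≥½ = 1-½≥0 ; y≤1 = ≈⇒0≤ (-‿inverseʳ 1#)
      ; y²≥x = 0≤-resp (+-congʳ (sym (*-identityˡ 1#))) x≤1
      ; rate = 0≤-resp (solve 2 (λ h x → (x :- h :* h) :+ h :* h
          := con (+ 1) :- (con (+ 1) :* con (+ 1) :- x)) refl ½ x)
                 (0≤-+ x≥¼ (square-≥0 ½))
      }
    approximation (suc k) = record
      { y = y a - ½ * (y a * y a - x)
      ; y≥½ = refine-≥½ (y≥½ a) (y≤1 a) ; y≤1 = refine-≤1 (y≤1 a) (y²≥x a)
      ; y²≥x = refine-square (y≤1 a) (y²≥x a) ; rate = refine-rate k (y≥½ a) (y²≥x a) (rate a)
      }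
      where a = approximation k

    private
      ys : ℕ → Carrier
      ys k = y (approximation k)

    opaque
      step : ∀ k → ys (suc k) - ys k ⊑ ½ * q ^ k
      step k =
        0≤-resp (solve 4 (λ h x y Q → h :* (Q :+ (y :* y :- x))
            := h :* Q :- ((y :- h :* (y :* y :- x)) :- y)) refl ½ x (ys k) (q ^ k))
          (0≤-* (0<⇒0≤ 0<½) (0≤-+ (0≤q^ k) (y²≥x (approximation k)))) ,
        0≤-resp (solve 4 (λ h x y Q → h :* (Q :- (y :* y :- x))
            := h :* Q :+ ((y :- h :* (y :* y :- x)) :- y)) refl ½ x (ys k) (q ^ k))
          (0≤-* (0<⇒0≤ 0<½) (rate (approximation k)))

      squares : (λ k → ys k * ys k) ⟶ x
      squares = 1# , λ k → ⊑-resp refl (sym (*-identityˡ (q ^ k)))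
        (rate (approximation k) , 0≤-+ (0≤q^ k) (y²≥x (approximation k)))

      -- The lower bound 1/2 is carried to the limit so that the root can be inverted in
      -- `principalRoot`.
      squareRoot : ∃[ y ] (y * y ≈ x × 0# ≤ y - ½)
      squareRoot = let l , ys⟶l = geometric-converges ys ½ step in
        l , ⟶-unique (⟶-* ys⟶l ys⟶l) squares ,
        ⟶-≥0 (λ k → y≥½ (approximation k)) (⟶-+ ys⟶l (⟶-const (- ½)))

-- Complex arithmetic, unit numbers and limits

module RingIdentities {c ℓ} (R : CommutativeRing c ℓ) where
  open CommutativeRing R
  open IntegerRingSolver R

  power-step : ∀ x y → y * (x - 1#) + (y - 1#) ≈ x * y - 1#
  power-step = solve 2 (λ x y → y :* (x :- con (+ 1)) :+ (y :- con (+ 1)) := x :* y :- con (+ 1)) refl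

  difference : ∀ x y → y * (x - 1#) ≈ x * y - y
  difference = solve 2 (λ x y → y :* (x :- con (+ 1)) := x :* y :- y) refl

  factor : ∀ x y z → x * (y * z) - x * y ≈ x * y * (z - 1#)
  factor = solve 3 (λ x y z → x :* (y :* z) :- x :* y := x :* y :* (z :- con (+ 1))) refl

module ComplexNumbers {c ℓ₁ ℓ₂} (ℝ : Reals c ℓ₁ ℓ₂) where
  open RealNumbers ℝ
  open IntegerRingSolver commutativeRing
  open Complex ℝ public using (ℂ; _+i_; re; im; ℂ-rawRing)
    renaming (_≈_ to _≈ᶜ_; _+_ to _+ᶜ_; _*_ to _*ᶜ_; -_ to -ᶜ_; 0# to 0ᶜ; 1# to 1ᶜ; _#_ to _#ᶜ_; _^_ to _^ᶜ_)

  opaque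
    *ᶜ-cong : ∀ {x y z w} → x ≈ᶜ y → z ≈ᶜ w → x *ᶜ z ≈ᶜ y *ᶜ w
    *ᶜ-cong (a , b) (c , d) = +-cong (*-cong a c) (-‿cong (*-cong b d)) , +-cong (*-cong a d)
        (*-cong b c)

    *ᶜ-assoc : ∀ x y z → (x *ᶜ y) *ᶜ z ≈ᶜ x *ᶜ (y *ᶜ z)
    *ᶜ-assoc (a +i b) (c +i d) (e +i f) =
      solve 6 (λ a b c d e f → (a :* c :- b :* d) :* e :- (a :* d :+ b :* c) :* f
          := a :* (c :* e :- d :* f) :- b :* (c :* f :+ d :* e)) refl a b c d e f ,
      solve 6 (λ a b c d e f → (a :* c :- b :* d) :* f :+ (a :* d :+ b :* c) :* e
          := a :* (c :* f :+ d :* e) :+ b :* (c :* e :- d :* f)) refl a b c d e f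

    *ᶜ-comm : ∀ x y → x *ᶜ y ≈ᶜ y *ᶜ x
    *ᶜ-comm (a +i b) (c +i d) =
      solve 4 (λ a b c d → a :* c :- b :* d := c :* a :- d :* b) refl a b c d ,
      solve 4 (λ a b c d → a :* d :+ b :* c := c :* b :+ d :* a) refl a b c d

    *ᶜ-identityˡ : ∀ x → 1ᶜ *ᶜ x ≈ᶜ x
    *ᶜ-identityˡ (a +i b) =
      solve 2 (λ a b → con (+ 1) :* a :- con (+ 0) :* b := a) refl a b ,
      solve 2 (λ a b → con (+ 1) :* b :+ con (+ 0) :* a := b) refl a b

    *ᶜ-distribˡ-+ᶜ : ∀ x y z → x *ᶜ (y +ᶜ z) ≈ᶜ x *ᶜ y +ᶜ x *ᶜ z
    *ᶜ-distribˡ-+ᶜ (a +i b) (c +i d) (e +i f) =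
      solve 6 (λ a b c d e f → a :* (c :+ e) :- b :* (d :+ f)
          := a :* c :- b :* d :+ (a :* e :- b :* f)) refl a b c d e f ,
      solve 6 (λ a b c d e f → a :* (d :+ f) :+ b :* (c :+ e)
          := a :* d :+ b :* c :+ (a :* f :+ b :* e)) refl a b c d e f

    ≈ᶜ-trans : ∀ {x y z} → x ≈ᶜ y → y ≈ᶜ z → x ≈ᶜ z
    ≈ᶜ-trans (a , b) (c , d) = trans a c , trans b d

    *ᶜ-identityʳ : ∀ x → x *ᶜ 1ᶜ ≈ᶜ x
    *ᶜ-identityʳ x = ≈ᶜ-trans (*ᶜ-comm x 1ᶜ) (*ᶜ-identityˡ x)

    *ᶜ-distribʳ-+ᶜ : ∀ x y z → (y +ᶜ z) *ᶜ x ≈ᶜ y *ᶜ x +ᶜ z *ᶜ x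
    *ᶜ-distribʳ-+ᶜ (a +i b) (c +i d) (e +i f) =
      solve 6 (λ a b c d e f → (c :+ e) :* a :- (d :+ f) :* b
          := c :* a :- d :* b :+ (e :* a :- f :* b)) refl a b c d e f ,
      solve 6 (λ a b c d e f → (c :+ e) :* b :+ (d :+ f) :* a
          := c :* b :+ d :* a :+ (e :* b :+ f :* a)) refl a b c d e f

  ℂ-commutativeRing : CommutativeRing c ℓ₁
  ℂ-commutativeRing = record
    { Carrier = ℂ ; _≈_ = _≈ᶜ_ ; _+_ = _+ᶜ_ ; _*_ = _*ᶜ_ ; -_ = -ᶜ_ ; 0# = 0ᶜ ; 1# = 1ᶜ
    ; isCommutativeRing = record
      { isRing = record
        { +-isAbelianGroup = record
          { isGroup = record
            { isMonoid = record
              { isSemigroup = record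
                { isMagma = record
                  { isEquivalence = record
                    { refl = refl , refl ; sym = λ (a , b) → sym a , sym b ; trans = ≈ᶜ-trans }
                  ; ∙-cong = λ (a , b) (c , d) → +-cong a c , +-cong b d }
                ; assoc = λ x y z → +-assoc _ _ _ , +-assoc _ _ _ }
              ; identity = (λ x → +-identityˡ _ , +-identityˡ _) ,
                  (λ x → +-identityʳ _ , +-identityʳ _) }
            ; inverse = (λ x → -‿inverseˡ _ , -‿inverseˡ _) , (λ x → -‿inverseʳ _ , -‿inverseʳ _)
            ; ⁻¹-cong = λ (a , b) → -‿cong a , -‿cong b }
          ; comm = λ x y → +-comm _ _ , +-comm _ _ }
        ; *-cong = *ᶜ-cong ; *-assoc = *ᶜ-assoc
        ; *-identity = *ᶜ-identityˡ , *ᶜ-identityʳ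
        ; distrib = *ᶜ-distribˡ-+ᶜ , *ᶜ-distribʳ-+ᶜ }
      ; *-comm = *ᶜ-comm } }

  private module ℂR = CommutativeRing ℂ-commutativeRing
  open ℂR public using () renaming (_-_ to _-ᶜ_)
  open Algebra.Properties.Semiring.Exp ℂR.semiring public
    using () renaming (^-homo-* to ^ᶜ-homo-*; ^-assocʳ to ^ᶜ-assocʳ; ^-congˡ to ^ᶜ-congˡ; ^-congʳ to ^ᶜ-congʳ)
  open Algebra.Properties.CommutativeSemiring.Exp ℂR.commutativeSemiring public
    using () renaming (^-distrib-* to ^ᶜ-distrib-*)

  open RingIdentities ℂ-commutativeRing public

  opaque
    ^ᶜ-double : ∀ {z w} m → w *ᶜ w ≈ᶜ z → w ^ᶜ (m ℕ.+ m) ≈ᶜ z ^ᶜ m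
    ^ᶜ-double {z} {w} m ww≈z = ℂR.trans (^ᶜ-homo-* w m m)
      (ℂR.trans (ℂR.sym (^ᶜ-distrib-* w w m)) (^ᶜ-congˡ m ww≈z))

  normSq : ℂ → Carrier
  normSq z = re z * re z + im z * im z

  Unit : ℂ → Set ℓ₁
  Unit z = normSq z ≈ 1#

  opaque
    normSq-cong : ∀ {z w} → z ≈ᶜ w → normSq z ≈ normSq w
    normSq-cong (a , b) = +-cong (*-cong a a) (*-cong b b)

    normSq-* : ∀ z w → normSq (z *ᶜ w) ≈ normSq z * normSq w
    normSq-* (a +i b) (c +i d) = solve 4 (λ a b c d →
      (a :* c :- b :* d) :* (a :* c :- b :* d) :+ (a :* d :+ b :* c) :* (a :* d :+ b :* c)
        := (a :* a :+ b :* b) :* (c :* c :+ d :* d)) refl a b c d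

    normSq-≥0 : ∀ z → 0# ≤ normSq z
    normSq-≥0 z = 0≤-+ (square-≥0 (re z)) (square-≥0 (im z))

    Unit-1 : Unit 1ᶜ
    Unit-1 = solve 0 (con (+ 1) :* con (+ 1) :+ con (+ 0) :* con (+ 0) := con (+ 1)) refl

    Unit-* : ∀ {z w} → Unit z → Unit w → Unit (z *ᶜ w)
    Unit-* {z} {w} uz uw = trans (normSq-* z w) (trans (*-cong uz uw) (*-identityˡ 1#))

    Unit-^ : ∀ {z} → Unit z → ∀ n → Unit (z ^ᶜ n)
    Unit-^ uz zero    = Unit-1
    Unit-^ {z} uz (suc n) = Unit-* {z} {z ^ᶜ n} uz (Unit-^ uz n)

  infix 4 _⊑ᶜ_ _⟶ᶜ_
  -- A square box in place of a disc reduces every estimate to the two coordinates; the price is the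
  -- factor 2 in `⊑ᶜ-*`.
  _⊑ᶜ_ : ℂ → Carrier → Set ℓ₂
  z ⊑ᶜ b = re z ⊑ b × im z ⊑ b

  _⟶ᶜ_ : (ℕ → ℂ) → ℂ → Set (c ⊔ ℓ₂)
  z ⟶ᶜ l = (re ∘ z) ⟶ re l × (im ∘ z) ⟶ im l

  opaque
    ⊑ᶜ-resp : ∀ {z w a b} → z ≈ᶜ w → a ≈ b → z ⊑ᶜ a → w ⊑ᶜ b
    ⊑ᶜ-resp (x , y) e (p , r) = ⊑-resp x e p , ⊑-resp y e r

    ⊑ᶜ-+ : ∀ {z w a b} → z ⊑ᶜ a → w ⊑ᶜ b → z +ᶜ w ⊑ᶜ a + b
    ⊑ᶜ-+ (x , y) (x′ , y′) = ⊑-+ x x′ , ⊑-+ y y′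

    ⊑ᶜ-* : ∀ {z w a b} → z ⊑ᶜ a → w ⊑ᶜ b → z *ᶜ w ⊑ᶜ a * b + a * b
    ⊑ᶜ-* (x , y) (x′ , y′) = ⊑-+ (⊑-* x x′) (⊑-neg (⊑-* y y′)) , ⊑-+ (⊑-* x y′) (⊑-* y x′)

    0⊑ᶜ : ∀ {b} → 0# ≤ b → 0ᶜ ⊑ᶜ b
    0⊑ᶜ {b} 0≤b = 0⊑ , 0⊑
      where
      0⊑ : 0# ⊑ b
      0⊑ = 0≤-resp (solve 1 (λ b → b := b :- con (+ 0)) refl b) 0≤b , 0≤-resp (sym (+-identityʳ b)) 0≤b

    Unit⇒⊑ᶜ1 : ∀ {z} → Unit z → z ⊑ᶜ 1#
    Unit⇒⊑ᶜ1 {x +i y} u =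
      square-≤⇒⊑ 0≤1 (0≤-resp
        (trans (sym (drop-0 _ _ (-≈0 (sym u)))) (solve 2 (λ x y → y :* y :+ con (+ 1) :*
            (con (+ 1) :- (x :* x :+ y :* y)) := con (+ 1) :* con (+ 1) :- x :* x) refl x y))
        (square-≥0 y)) ,
      square-≤⇒⊑ 0≤1 (0≤-resp
        (trans (sym (drop-0 _ _ (-≈0 (sym u)))) (solve 2 (λ x y → x :* x :+ con (+ 1) :*
            (con (+ 1) :- (x :* x :+ y :* y)) := con (+ 1) :* con (+ 1) :- y :* y) refl x y))
        (square-≥0 x))

    ⟶ᶜ-resp : ∀ {z w l m} → (∀ k → z k ≈ᶜ w k) → l ≈ᶜ m → z ⟶ᶜ l → w ⟶ᶜ m
    ⟶ᶜ-resp e (a , b) (x , y) = ⟶-resp (proj₁ ∘ e) a x , ⟶-resp (proj₂ ∘ e) b y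

    ⟶ᶜ-const : ∀ l → (λ _ → l) ⟶ᶜ l
    ⟶ᶜ-const l = ⟶-const (re l) , ⟶-const (im l)

    ⟶ᶜ-* : ∀ {z w l m} → z ⟶ᶜ l → w ⟶ᶜ m → (λ k → z k *ᶜ w k) ⟶ᶜ l *ᶜ m
    ⟶ᶜ-* (x , y) (x′ , y′) = ⟶-+ (⟶-* x x′) (⟶-neg (⟶-* y y′)) , ⟶-+ (⟶-* x y′) (⟶-* y x′)

    ⟶ᶜ-^ : ∀ {z l} → z ⟶ᶜ l → ∀ n → (λ k → z k ^ᶜ n) ⟶ᶜ l ^ᶜ n
    ⟶ᶜ-^ z⟶l zero    = ⟶ᶜ-const 1ᶜ
    ⟶ᶜ-^ {z} z⟶l (suc n) = ⟶ᶜ-* {z = z} z⟶l (⟶ᶜ-^ z⟶l n)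

    ⟶ᶜ-unique : ∀ {z l m} → z ⟶ᶜ l → z ⟶ᶜ m → l ≈ᶜ m
    ⟶ᶜ-unique (x , y) (x′ , y′) = ⟶-unique x x′ , ⟶-unique y y′

    Unit-limit : ∀ {z l} → z ⟶ᶜ l → (∀ k → Unit (z k)) → Unit l
    Unit-limit (x , y) u = ⟶-unique (⟶-+ (⟶-* x x) (⟶-* y y)) (⟶-resp (λ k → sym (u k)) refl
        (⟶-const 1#))

    geometric-convergesᶜ : ∀ z B → (∀ k → z (suc k) -ᶜ z k ⊑ᶜ B * q ^ k) → ∃[ l ] (z ⟶ᶜ l)
    geometric-convergesᶜ z B step =
      let a , z⟶a = geometric-converges (re ∘ z) B (proj₁ ∘ step)
          b , z⟶b = geometric-converges (im ∘ z) B (proj₂ ∘ step)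
      in a +i b , z⟶a , z⟶b

  opaque
    -- `B` is 2n: in gᵐ⁺¹ - 1 = gᵐ (g - 1) + (gᵐ - 1) the first summand costs 2Q. The bound is
    -- uniform in g and m because in `rem-power` both vary with k.
    powers-near-1 : ∀ n → ∃[ B ] (0# ≤ B × (∀ {g Q} → Unit g → 0# ≤ Q → g -ᶜ 1ᶜ ⊑ᶜ Q →
      ∀ {m} → m ℕ.≤ n → g ^ᶜ m -ᶜ 1ᶜ ⊑ᶜ B * Q))
    powers-near-1 zero = 0# , ≈⇒0≤ refl , λ { u 0≤Q near z≤n →
      ⊑ᶜ-resp (ℂR.sym (ℂR.-‿inverseʳ 1ᶜ)) refl (0⊑ᶜ (0≤-* (≈⇒0≤ refl) 0≤Q)) }
    powers-near-1 (suc n) with powers-near-1 n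
    ... | B , 0≤B , bound = 1# + 1# + B , 0≤-+ (0<⇒0≤ 0<2) 0≤B , λ
      { u 0≤Q near z≤n → ⊑ᶜ-resp (ℂR.sym (ℂR.-‿inverseʳ 1ᶜ)) refl
          (0⊑ᶜ (0≤-* (0≤-+ (0<⇒0≤ 0<2) 0≤B) 0≤Q))
      ; {g} {Q} u 0≤Q near {suc m} (s≤s m≤n) → ⊑ᶜ-resp (power-step g (g ^ᶜ m))
          (solve 2 (λ B Q → con (+ 1) :* Q :+ con (+ 1) :* Q :+ B :* Q
              := (con (+ 2) :+ B) :* Q) refl B Q)
          (⊑ᶜ-+ (⊑ᶜ-* (Unit⇒⊑ᶜ1 (Unit-^ u m)) near) (bound u 0≤Q near m≤n)) }

-- Binary expansion of 1/n

2^ : ℕ → ℕ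
2^ zero    = 1
2^ (suc k) = 2^ k ℕ.+ 2^ k

halve : ∀ m → ∃[ h ] (m ≡ h ℕ.+ h ⊎ m ≡ suc (h ℕ.+ h))
halve zero = 0 , inj₁ ≡.refl
halve (suc m) with halve m
... | h , inj₁ ≡.refl = h , inj₂ ≡.refl
... | h , inj₂ ≡.refl = suc h , inj₁ (≡.cong suc (≡.sym (ℕ.+-suc h h)))

halve-≤ : ∀ {h k} → h ℕ.+ h ℕ.≤ k ℕ.+ k → h ℕ.≤ k
halve-≤ {h} {k} h+h≤k+k with h ℕ.≤? k
... | yes h≤k = h≤k
... | no  h≰k = ⊥-elim (ℕ.<⇒≱ (ℕ.+-mono-< (ℕ.≰⇒> h≰k) (ℕ.≰⇒> h≰k)) h+h≤k+k)

halve-< : ∀ {h k} → suc (h ℕ.+ h) ℕ.≤ k ℕ.+ k → suc h ℕ.≤ k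
halve-< {h} {k} h+h<k+k with h ℕ.<? k
... | yes h<k = h<k
... | no  h≮k = ⊥-elim (ℕ.<⇒≱ h+h<k+k (ℕ.+-mono-≤ (ℕ.≮⇒≥ h≮k) (ℕ.≮⇒≥ h≮k)))

-- digits k / 2ᵏ is 1 / n truncated to k binary digits, of the two expansions
-- the one that does not terminate (hence rem ≤ n rather than rem < n).
module BinaryReciprocal (n : ℕ) (1≤n : 1 ℕ.≤ n) where
  open Data.Nat.Solver.+-*-Solver

  record Division (k : ℕ) : Set where
    constructor division
    field
      quot rem : ℕ
      rem≤n    : rem ℕ.≤ n
      exact    : quot ℕ.* n ℕ.+ rem ≡ 2^ k
  open Division public

  -- Passing to 2ᵏ⁺¹ doubles quotient and remainder, with one carry when the new remainder exceeds
  -- n. A tie 2s = n gets the digit 0, which selects the expansion that does not terminate.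
  refine : ∀ {k} (d : Division k) → Σ[ d′ ∈ Division (suc k) ]
    (quot d′ ≡ quot d ℕ.+ quot d ⊎ quot d′ ≡ suc (quot d ℕ.+ quot d))
  refine {k} (division a s s≤n exact) with s ℕ.+ s ℕ.≤? n
  ... | yes 2s≤n = division (a ℕ.+ a) (s ℕ.+ s) 2s≤n doubled , inj₁ ≡.refl
    where
    doubled : (a ℕ.+ a) ℕ.* n ℕ.+ (s ℕ.+ s) ≡ 2^ (suc k)
    doubled = ≡.trans
      (solve 3 (λ a s n → (a :+ a) :* n :+ (s :+ s) := (a :* n :+ s) :+ (a :* n :+ s)) ≡.refl a s n)
      (≡.cong₂ ℕ._+_ exact exact)
  ... | no  2s≰n = division (suc (a ℕ.+ a)) (s ℕ.+ s ℕ.∸ n)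
    (ℕ.≤-trans (ℕ.∸-monoˡ-≤ n (ℕ.+-mono-≤ s≤n s≤n)) (ℕ.≤-reflexive (ℕ.m+n∸n≡m n n)))
    doubled , inj₂ ≡.refl
    where
    doubled : suc (a ℕ.+ a) ℕ.* n ℕ.+ (s ℕ.+ s ℕ.∸ n) ≡ 2^ (suc k)
    doubled = ≡.trans
      (solve 3 (λ a n r → (con 1 :+ (a :+ a)) :* n :+ r
          := (a :+ a) :* n :+ (n :+ r)) ≡.refl a n (s ℕ.+ s ℕ.∸ n))
      (≡.trans (≡.cong ((a ℕ.+ a) ℕ.* n ℕ.+_) (ℕ.m+[n∸m]≡n (ℕ.≰⇒≥ 2s≰n)))
      (≡.trans
        (solve 3 (λ a s n → (a :+ a) :* n :+ (s :+ s) := (a :* n :+ s) :+ (a :* n :+ s)) ≡.refl a s n)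
        (≡.cong₂ ℕ._+_ exact exact)))

  divide : ∀ k → Division k
  -- Quotient 0 is taken even for n = 1, where the remainder 1 equals n.
  divide zero    = division 0 1 1≤n ≡.refl
  divide (suc k) = proj₁ (refine (divide k))

  digits : ℕ → ℕ
  digits k = quot (divide k)

  digits-suc : ∀ k → digits (suc k) ≡ digits k ℕ.+ digits k ⊎ digits (suc k) ≡ suc
      (digits k ℕ.+ digits k)
  digits-suc k = proj₂ (refine (divide k))

  digits-≤ : ∀ k {m} → m ℕ.≤ n → digits k ℕ.* m ℕ.≤ 2^ k
  digits-≤ k m≤n = ℕ.≤-trans (ℕ.*-monoʳ-≤ (digits k) m≤n)
    (≡.subst (digits k ℕ.* n ℕ.≤_) (exact (divide k)) (ℕ.m≤m+n _ _))

-- Roots of unit numbers by angle bisection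

module ComplexRoots {c ℓ₁ ℓ₂} (ℝ : Reals c ℓ₁ ℓ₂) where
  open RealNumbers ℝ
  open RealSquareRoot ℝ
  open ComplexNumbers ℝ
  open IntegerRingSolver commutativeRing
  private module ℂR = CommutativeRing ℂ-commutativeRing

  Quadrant : ℂ → Set ℓ₂
  Quadrant z = 0# ≤ re z × 0# ≤ im z

  opaque
    Quadrant-resp : ∀ {z w} → z ≈ᶜ w → Quadrant z → Quadrant w
    Quadrant-resp (x , y) (a , b) = 0≤-resp x a , 0≤-resp y b

  -- The root of g with positive real part bisects the angle between 1 and g,
  -- so it is a positive multiple of 1 + g.
  record PrincipalRoot (g : ℂ) : Set (c ⊔ ℓ₁ ⊔ ℓ₂) where
    field
      scale   : Carrier
      scale≥0 : 0# ≤ scale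
      scale²  : scale * scale * ((1# + re g) + (1# + re g)) ≈ 1#

    root : ℂ
    root = (scale * (1# + re g)) +i (scale * im g)
  open PrincipalRoot public

  opaque
    re≤1 : ∀ {g} → Unit g → 0# ≤ 1# - re g
    re≤1 u = proj₁ (proj₁ (Unit⇒⊑ᶜ1 u))

    re≥-1 : ∀ {g} → Unit g → 0# ≤ 1# + re g
    re≥-1 u = proj₂ (proj₁ (Unit⇒⊑ᶜ1 u))

    -- Here `y` is the cosine of half the angle, with y² = (1 + x)/2. Since |1 + g| = 2y, the scale
    -- 1/|1 + g| is `½ * r`.
    scale-from-cosine : ∀ x {y r} → y * y ≈ (1# + x) * ½ → y * r ≈ 1# →
      (½ * r) * (½ * r) * ((1# + x) + (1# + x)) ≈ 1#
    scale-from-cosine x {y} {r} yy≈ yr≈1 =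
      trans (solve 3 (λ x h r → (h :* r) :* (h :* r) :* ((con (+ 1) :+ x) :+ (con (+ 1) :+ x))
          := (h :+ h) :* (r :* r :* ((con (+ 1) :+ x) :* h))) refl x ½ r)
      (trans (*-cong ½+½≈1 (*-congˡ (sym yy≈)))
      (trans (solve 2 (λ y r → con (+ 1) :* (r :* r :* (y :* y)) := (y :* r) :* (y :* r)) refl y r)
      (trans (*-cong yr≈1 yr≈1) (*-identityˡ 1#))))

    -- The bound Re g ≥ -1/2 places (1 + Re g)/2 between 1/4 and 1, where `squareRoot` applies.
    principalRoot : ∀ {g} → Unit g → 0# ≤ re g + ½ → PrincipalRoot g
    principalRoot {g} u re≥-½ =
      let y , yy≈ , y≥½ = squareRoot ((1# + re g) * ½) lower upper
          r , yr≈1 , 0<r = reciprocal (<-respʳ (solve 2 (λ h y → h :+ (y :- h)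
              := y) refl ½ y) (0<-+ 0<½ y≥½))
      in record
        { scale = ½ * r ; scale≥0 = 0<⇒0≤ (*-pos 0<½ 0<r)
        ; scale² = scale-from-cosine (re g) yy≈ yr≈1 }
      where
      lower : 0# ≤ (1# + re g) * ½ - ½ * ½
      lower = 0≤-resp (trans
        (solve 2 (λ h x → h :* (x :+ h)
            := (con (+ 1) :+ x) :* h :- h :* h :+ h :* (h :+ h :- con (+ 1))) refl ½ (re g))
        (drop-0 _ _ ½+½-1≈0)) (0≤-* (0<⇒0≤ 0<½) re≥-½)
      upper : 0# ≤ 1# - (1# + re g) * ½
      upper = 0≤-resp (trans
        (solve 2 (λ h x → h :* (con (+ 1) :- x)
            := con (+ 1) :- (con (+ 1) :+ x) :* h :+ con (+ 1) :* (h :+ h :- con (+ 1))) refl ½ (re g))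
        (drop-0 _ _ ½+½-1≈0)) (0≤-* (0<⇒0≤ 0<½) (re≤1 u))

  module _ {g} (u : Unit g) (p : PrincipalRoot g) where
    private
      s = scale p
      x = re g
      y = im g

      u-1≈0 : x * x + y * y - 1# ≈ 0#
      u-1≈0 = -≈0 u

      s²-1≈0 : s * s * ((1# + x) + (1# + x)) - 1# ≈ 0#
      s²-1≈0 = -≈0 (scale² p)

    opaque
      root-square : root p *ᶜ root p ≈ᶜ g
      root-square =
        trans (solve 3 (λ s x y → (s :* (con (+ 1) :+ x)) :* (s :* (con (+ 1) :+ x)) :- (s :* y) :*
            (s :* y)
            := x :+ x :* (s :* s :* ((con (+ 1) :+ x) :+ (con (+ 1) :+ x)) :- con (+ 1)) :+
                (:- (s :* s)) :* (x :* x :+ y :* y :- con (+ 1))) refl s x y)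
          (trans (drop-0 _ _ u-1≈0) (drop-0 _ _ s²-1≈0)) ,
        trans (solve 3 (λ s x y → (s :* (con (+ 1) :+ x)) :* (s :* y) :+ (s :* y) :*
            (s :* (con (+ 1) :+ x))
            := y :+ y :* (s :* s :* ((con (+ 1) :+ x) :+ (con (+ 1) :+ x)) :- con (+ 1))) refl s x y)
          (drop-0 _ _ s²-1≈0)

      root-unit : Unit (root p)
      root-unit = trans
        (solve 3 (λ s x y → (s :* (con (+ 1) :+ x)) :* (s :* (con (+ 1) :+ x)) :+ (s :* y) :* (s :* y)
            := con (+ 1) :+ con (+ 1) :* (s :* s :* ((con (+ 1) :+ x) :+
                (con (+ 1) :+ x)) :- con (+ 1)) :+ s :* s :*
                (x :* x :+ y :* y :- con (+ 1))) refl s x y)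
        (trans (drop-0 _ _ u-1≈0) (drop-0 _ _ s²-1≈0))

      root-re≥0 : 0# ≤ re (root p)
      root-re≥0 = 0≤-* (scale≥0 p) (re≥-1 u)

      -- From 2 s² (1 + x) = 1 and x ≥ 0 follows s² ≤ 1/2, which is below q² = 9/16.
      scale≤q : 0# ≤ re g → scale p ⊑ q
      scale≤q 0≤x = square-≤⇒⊑ 0≤q (0≤-halve (0≤-resp
        (sym (trans (solve 3 (λ h s x → let q = con (+ 1) :- h :* h in (q :* q :- s :* s) :+ (q :* q :- s :* s)
            := h :* h :* h :+ (s :* s :* x :+ s :* s :* x) :+ (h :* h :* h :- (h :+ h) :- con (+ 1)) :*
                (h :+ h :- con (+ 1))
               :+ (:- con (+ 1)) :* (s :* s :* ((con (+ 1) :+ x) :+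
                   (con (+ 1) :+ x)) :- con (+ 1))) refl ½ s x)
          (trans (drop-0 _ _ s²-1≈0) (drop-0 _ _ ½+½-1≈0))))
        (0≤-+ (0≤-* (square-≥0 ½) (0<⇒0≤ 0<½)) (0≤-+ (0≤-* (square-≥0 s) 0≤x)
            (0≤-* (square-≥0 s) 0≤x)))))

  opaque
    -- On the right half circle 1 - x ≤ 1 - x² = y² ≤ Q² ≤ Q, so the imaginary part alone controls
    -- the distance to 1.
    near-1 : ∀ {g Q} → Unit g → 0# ≤ re g → 0# ≤ 1# - Q → im g ⊑ Q → g -ᶜ 1ᶜ ⊑ᶜ Q
    near-1 {x +i y} {Q} u 0≤x Q≤1 y⊑Q =
      (0≤-resp (solve 2 (λ x Q → Q :+ (con (+ 1) :- x)
          := Q :- (x :- con (+ 1))) refl x Q) (0≤-+ 0≤Q (re≤1 u)) ,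
       0≤-resp (trans (solve 3 (λ x y Q → Q :* (con (+ 1) :- Q) :+ (Q :- y) :* (Q :+ y) :+ x :*
           (con (+ 1) :- x)
            := Q :+ (x :- con (+ 1)) :+ (:- con (+ 1)) :* (x :* x :+ y :* y :- con (+ 1))) refl x y Q)
          (drop-0 _ _ (-≈0 u)))
         (0≤-+ (0≤-+ (0≤-* 0≤Q Q≤1) (0≤-* (proj₁ y⊑Q) (proj₂ y⊑Q))) (0≤-* 0≤x (re≤1 u)))) ,
      ⊑-resp (solve 1 (λ y → y := y :- con (+ 0)) refl y) refl y⊑Q
      where
      0≤Q : 0# ≤ Q
      0≤Q = ⊑⇒0≤ y⊑Q

  module RootTower (g₀ : ℂ) (u₀ : Unit g₀) (re₀ : 0# ≤ re g₀) where

    record RightHalfCircle : Set (c ⊔ ℓ₁ ⊔ ℓ₂) where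
      field
        value : ℂ
        unit  : Unit value
        re≥0  : 0# ≤ re value
    open RightHalfCircle

    descend : (l : RightHalfCircle) → PrincipalRoot (value l)
    descend l = principalRoot (unit l) (0≤-+ (re≥0 l) (0<⇒0≤ 0<½))

    level : ℕ → RightHalfCircle
    level zero    = record { value = g₀ ; unit = u₀ ; re≥0 = re₀ }
    level (suc k) = record { value = root p ; unit = root-unit (unit l) p ; re≥0 = root-re≥0
        (unit l) p }
      where
      l = level k
      p = descend l

    g : ℕ → ℂ
    g k = value (level k)

    g-unit : ∀ k → Unit (g k)
    g-unit k = unit (level k)

    opaque
      g-square : ∀ k → g (suc k) *ᶜ g (suc k) ≈ᶜ g k
      g-square k = root-square (g-unit k) (descend (level k))

      im-g : ∀ k → im (g k) ⊑ q ^ k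
      im-g zero    = proj₂ (Unit⇒⊑ᶜ1 u₀)
      im-g (suc k) = ⊑-* (scale≤q (g-unit k) (descend (level k)) (re≥0 (level k))) (im-g k)

      g-near-1 : ∀ k → g k -ᶜ 1ᶜ ⊑ᶜ q ^ k
      g-near-1 k = near-1 (g-unit k) (re≥0 (level k)) (q^≤1 k) (im-g k)

      g^2^k : ∀ k → g k ^ᶜ 2^ k ≈ᶜ g₀
      g^2^k zero    = *ᶜ-identityʳ g₀
      g^2^k (suc k) = ℂR.trans (^ᶜ-double (2^ k) (g-square k)) (g^2^k k)

      -- An odd power of g (suc k) bisects two consecutive powers of g k.
      g-odd-power : ∀ k h → let s = scale (descend (level k)) ; w = g k ^ᶜ h ; w′ = g k ^ᶜ suc h in
        g (suc k) ^ᶜ suc (h ℕ.+ h) ≈ᶜ ((s * (re w + re w′)) +i (s * (im w + im w′)))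
      g-odd-power k h = ℂR.trans (*ᶜ-cong {x = g (suc k)} ℂR.refl (^ᶜ-double h (g-square k))) (
        solve 5 (λ s x y a b → (s :* (con (+ 1) :+ x)) :* a :- (s :* y) :* b
            := s :* (a :+ (x :* a :- y :* b))) refl _ _ _ _ _ ,
        solve 5 (λ s x y a b → (s :* (con (+ 1) :+ x)) :* b :+ (s :* y) :* a
            := s :* (b :+ (x :* b :+ y :* a))) refl _ _ _ _ _)

      -- The quadrant is a convex cone. Even powers already occur at the previous level, and an odd
      -- one is a nonnegative multiple of the sum of two neighbours there. Both neighbours are in
      -- range, since an odd number cannot equal 2ᵏ⁺¹.
      g-quadrant : 0# ≤ im g₀ → ∀ k {m} → m ℕ.≤ 2^ k → Quadrant (g k ^ᶜ m)
      g-quadrant im₀ zero {zero}        m≤ = 0≤1 , ≈⇒0≤ refl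
      g-quadrant im₀ zero {suc zero}    m≤ = Quadrant-resp (ℂR.sym (*ᶜ-identityʳ g₀)) (re₀ , im₀)
      g-quadrant im₀ zero {suc (suc m)} (s≤s ())
      g-quadrant im₀ (suc k) {m} m≤ = by-parity (halve m) m≤
        where
        by-parity : ∀ {m} → ∃[ h ] (m ≡ h ℕ.+ h ⊎ m ≡ suc (h ℕ.+ h)) → m ℕ.≤ 2^ (suc k) →
            Quadrant (g (suc k) ^ᶜ m)
        by-parity (h , inj₁ ≡.refl) m≤ = Quadrant-resp (ℂR.sym (^ᶜ-double h (g-square k)))
            (g-quadrant im₀ k {h} (halve-≤ {h} m≤))
        by-parity (h , inj₂ ≡.refl) m≤ = Quadrant-resp (ℂR.sym (g-odd-power k h))
          (0≤-* s≥0 (0≤-+ (proj₁ w) (proj₁ w′)) , 0≤-* s≥0 (0≤-+ (proj₂ w) (proj₂ w′)))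
          where
          s≥0 : 0# ≤ scale (descend (level k))
          s≥0 = scale≥0 (descend (level k))
          w : Quadrant (g k ^ᶜ h)
          w = g-quadrant im₀ k {h} (ℕ.<⇒≤ (halve-< m≤))
          w′ : Quadrant (g k ^ᶜ suc h)
          w′ = g-quadrant im₀ k {suc h} (halve-< m≤)

    module _ (n : ℕ) (1≤n : 1 ℕ.≤ n) where
      open BinaryReciprocal n 1≤n

      r : ℕ → ℂ
      r k = g k ^ᶜ digits k

      opaque
        -- A new digit 0 leaves `r k` unchanged; a new digit 1 multiplies it by `g (suc k)`, which
        -- is within qᵏ⁺¹ of 1.
        r-step : ∀ k → r (suc k) -ᶜ r k ⊑ᶜ (q + q) * q ^ k
        r-step k = by-digit (digits-suc k)
          where
          by-digit : ∀ {d} → d ≡ digits k ℕ.+ digits k ⊎ d ≡ suc (digits k ℕ.+ digits k) →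
            g (suc k) ^ᶜ d -ᶜ r k ⊑ᶜ (q + q) * q ^ k
          by-digit (inj₁ ≡.refl) = ⊑ᶜ-resp
            (ℂR.sym (ℂR.trans (ℂR.+-congʳ (^ᶜ-double (digits k) (g-square k)))
                (ℂR.-‿inverseʳ (r k)))) refl
            (0⊑ᶜ (0≤-* (0≤-+ 0≤q 0≤q) (0≤q^ k)))
          by-digit (inj₂ ≡.refl) = ⊑ᶜ-resp
            (ℂR.trans (difference (g (suc k)) (r k))
                (ℂR.+-congʳ (ℂR.*-congˡ {x = g (suc k)} (ℂR.sym (^ᶜ-double (digits k) (g-square k))))))
            (solve 2 (λ q Q → con (+ 1) :* (q :* Q) :+ con (+ 1) :* (q :* Q)
                := (q :+ q) :* Q) refl q (q ^ k))
            (⊑ᶜ-* (Unit⇒⊑ᶜ1 (Unit-^ (g-unit k) (digits k))) (g-near-1 (suc k)))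

        r-power : ∀ k → r k ^ᶜ n *ᶜ g k ^ᶜ rem (divide k) ≈ᶜ g₀
        r-power k = ℂR.trans (ℂR.*-congʳ (^ᶜ-assocʳ (g k) (digits k) n))
          (ℂR.trans (ℂR.sym (^ᶜ-homo-* (g k) (digits k ℕ.* n) (rem (divide k))))
          (ℂR.trans (^ᶜ-congʳ (g k) (exact (divide k))) (g^2^k k)))

        rem-power : (λ k → g k ^ᶜ rem (divide k)) ⟶ᶜ 1ᶜ
        rem-power = let B , _ , bound = powers-near-1 n in
          (B , λ k → proj₁ (bound (g-unit k) (0≤q^ k) (g-near-1 k) (rem≤n (divide k)))) ,
          (B , λ k → proj₂ (bound (g-unit k) (0≤q^ k) (g-near-1 k) (rem≤n (divide k))))

        -- The equation zⁿ = g₀ does not tell the n roots apart. The quadrant clause singles out the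
        -- one of smallest angle, and it passes to the limit because its inequalities are weak.
        nthRoot : ∃[ z ] (Unit z × z ^ᶜ n ≈ᶜ g₀ × (0# ≤ im g₀ → ∀ {m} → m ℕ.≤ n → Quadrant (z ^ᶜ m)))
        nthRoot =
          let z , r⟶z = geometric-convergesᶜ r (q + q) r-step in
          z , Unit-limit r⟶z (λ k → Unit-^ (g-unit k) (digits k)) ,
          ℂR.trans (ℂR.sym (*ᶜ-identityʳ (z ^ᶜ n)))
            (⟶ᶜ-unique (⟶ᶜ-* (⟶ᶜ-^ r⟶z n) rem-power) (⟶ᶜ-resp (λ k → ℂR.sym (r-power k)) ℂR.refl
                (⟶ᶜ-const g₀))) ,
          λ im₀ {m} m≤n →
            let powers = ⟶ᶜ-^ r⟶z m
                quadrant : ∀ k → Quadrant (r k ^ᶜ m)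
                quadrant k = Quadrant-resp (ℂR.sym (^ᶜ-assocʳ (g k) (digits k) m))
                    (g-quadrant im₀ k (digits-≤ k m≤n))
            in ⟶-≥0 (proj₁ ∘ quadrant) (proj₁ powers) , ⟶-≥0 (proj₂ ∘ quadrant) (proj₂ powers)

-- Apartness of complex numbers and zeros of products

all-or : ∀ {a p} {A : Set a} {n} {P : Fin n → Set p} → (∀ i → A ⊎ P i) → A ⊎ (∀ i → P i)
all-or {n = zero}  f = inj₂ λ ()
all-or {n = suc n} f with f zero | all-or (f ∘ suc)
... | inj₁ a | _      = inj₁ a
... | inj₂ _ | inj₁ a = inj₁ a
... | inj₂ p | inj₂ g = inj₂ λ { zero → p ; (suc i) → g i }

module ComplexApartness {c ℓ₁ ℓ₂} (ℝ : Reals c ℓ₁ ℓ₂) where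
  open RealNumbers ℝ
  open ComplexNumbers ℝ
  open IntegerRingSolver commutativeRing
  open Algebra.Properties.CommutativeMonoid.Sum (CommutativeRing.*-commutativeMonoid ℂ-commutativeRing)
    using () renaming (sum to product)
  private module ℂR = CommutativeRing ℂ-commutativeRing

  -- Equivalent to `#ᶜ`, but compatible with products because `normSq` is multiplicative.
  Apart : ℂ → ℂ → Set ℓ₂
  Apart z w = 0# < normSq (z -ᶜ w)

  opaque
    #⇒-#0 : ∀ {x y} → x # y → x - y # 0#
    #⇒-#0 {x} {y} (inj₁ x<y) = inj₁ (0<-⇒<0 (<-respʳ (solve 2 (λ x y → y :- x
        := :- (x :- y)) refl x y) (<⇒0< x<y)))
    #⇒-#0 (inj₂ y<x) = inj₂ (<⇒0< y<x)

    -#0⇒# : ∀ {x y} → x - y # 0# → x # y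
    -#0⇒# {x} {y} (inj₁ x-y<0) = inj₁ (0<⇒< (<-respʳ (solve 2 (λ x y → :- (x :- y)
        := y :- x) refl x y) (<0⇒0< x-y<0)))
    -#0⇒# (inj₂ 0<x-y) = inj₂ (0<⇒< 0<x-y)

    Apart⇒# : ∀ {z w} → Apart z w → z #ᶜ w
    Apart⇒# p = Sum.map (λ a → -#0⇒# (*-#0 (inj₂ a))) (λ a → -#0⇒# (*-#0 (inj₂ a))) (0<-+⁻ p)

    #⇒Apart : ∀ {z w} → z #ᶜ w → Apart z w
    #⇒Apart (inj₁ a) = 0<-+ (square-pos (#⇒-#0 a)) (square-≥0 _)
    #⇒Apart (inj₂ a) = <-respʳ (+-comm _ _) (0<-+ (square-pos (#⇒-#0 a)) (square-≥0 _))

    #ᶜ-cotrans : ∀ {z w} → z #ᶜ w → ∀ v → v #ᶜ z ⊎ v #ᶜ w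
    #ᶜ-cotrans (inj₁ a) v = Sum.map (inj₁ ∘ Sum.swap) inj₁ (#-cotrans a (re v))
    #ᶜ-cotrans (inj₂ a) v = Sum.map (inj₂ ∘ Sum.swap) inj₂ (#-cotrans a (im v))

    Apart-sym : ∀ {z w} → Apart z w → Apart w z
    Apart-sym {z} {w} = <-respʳ (solve 4 (λ a b x y → (a :- x) :* (a :- x) :+ (b :- y) :* (b :- y)
        := (x :- a) :* (x :- a) :+ (y :- b) :* (y :- b)) refl (re z) (im z) (re w) (im w))

    Apart-cotrans : ∀ {z w} → Apart z w → ∀ v → Apart v z ⊎ Apart v w
    Apart-cotrans p v = Sum.map #⇒Apart #⇒Apart (#ᶜ-cotrans (Apart⇒# p) v)

    -- Multiplying `z *ᶜ w` by the conjugate of `z` yields `normSq z` times `w`, which reduces the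
    -- claim to cancellation by a positive real.
    normSq-pos-cancel : ∀ {z w} → 0# < normSq z → z *ᶜ w ≈ᶜ 0ᶜ → w ≈ᶜ 0ᶜ
    normSq-pos-cancel {a +i b} {x +i y} 0<n (r≈0 , i≈0) =
      *-cancel 0<n (trans (solve 4 (λ a b x y → (a :* a :+ b :* b) :* x
          := con (+ 0) :+ a :* (a :* x :- b :* y) :+ b :* (a :* y :+ b :* x)) refl a b x y)
        (trans (drop-0 _ _ i≈0) (drop-0 _ _ r≈0))) ,
      *-cancel 0<n (trans (solve 4 (λ a b x y → (a :* a :+ b :* b) :* y
          := con (+ 0) :+ (:- b) :* (a :* x :- b :* y) :+ a :* (a :* y :+ b :* x)) refl a b x y)
        (trans (drop-0 _ _ i≈0) (drop-0 _ _ r≈0)))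

    product-apart : ∀ {n} (f : Vector ℂ n) → (∀ i → 0# < normSq (f i)) → 0# < normSq (product f)
    product-apart {zero}  f 0<f = <-respʳ (sym Unit-1) 0<1
    product-apart {suc n} f 0<f = <-respʳ (sym (normSq-* (f zero) (product (f ∘ suc))))
      (*-pos (0<f zero) (product-apart (f ∘ suc) (0<f ∘ suc)))

    -- Pairwise apartness of the roots makes this constructive: z is apart from
    -- every root but at most one.
    product-zero : ∀ {n} (μ : Vector ℂ n) → (∀ i j → i ≢ j → Apart (μ i) (μ j)) →
      ∀ z → product (λ i → z -ᶜ μ i) ≈ᶜ 0ᶜ → ∃[ i ] (z ≈ᶜ μ i)
    product-zero {zero}  μ apart z (1≈0 , _) = ⊥-elim (<-irrefl (sym 1≈0) 0<1)
    product-zero {suc n} μ apart z p≈0 =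
      locate (all-or (λ j → Apart-cotrans (apart zero (suc j) λ ()) z))
      where
      locate : Apart z (μ zero) ⊎ (∀ j → Apart z (μ (suc j))) → ∃[ i ] (z ≈ᶜ μ i)
      locate (inj₁ z#μ₀) =
        let i , z≈ = product-zero (μ ∘ suc) (λ i j i≢j → apart (suc i) (suc j)
                (i≢j ∘ Fin.suc-injective)) z (normSq-pos-cancel z#μ₀ p≈0)
        in suc i , z≈
      locate (inj₂ z#μ) = zero , -≈0⁻ (proj₁ z-μ₀≈0) , -≈0⁻ (proj₂ z-μ₀≈0)
        where
        -≈0⁻ : ∀ {x y} → x - y ≈ 0# → x ≈ y
        -≈0⁻ {x} {y} e = trans (solve 2 (λ x y → x
            := y :+ con (+ 1) :* (x :- y)) refl x y) (drop-0 _ _ e)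
        rest : ℂ
        rest = product (λ j → z -ᶜ μ (suc j))
        z-μ₀≈0 : z -ᶜ μ zero ≈ᶜ 0ᶜ
        z-μ₀≈0 = normSq-pos-cancel {rest} (product-apart (λ j → z -ᶜ μ (suc j)) z#μ)
          (ℂR.trans (ℂR.*-comm rest (z -ᶜ μ zero)) p≈0)

-- Primitive roots of unity and roots of arbitrary unit numbers

module RootsOfUnity {c ℓ₁ ℓ₂} (ℝ : Reals c ℓ₁ ℓ₂) (n : ℕ) (1≤n : 1 ℕ.≤ n) where
  open RealNumbers ℝ
  open ComplexNumbers ℝ
  open ComplexApartness ℝ
  open ComplexRoots ℝ
  open IntegerRingSolver commutativeRing
  private module ℂR = CommutativeRing ℂ-commutativeRing

  𝕚 : ℂ
  𝕚 = 0# +i 1#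

  opaque
    𝕚-unit : Unit 𝕚
    𝕚-unit = solve 0 (con (+ 0) :* con (+ 0) :+ con (+ 1) :* con (+ 1) := con (+ 1)) refl

    𝕚-root : ∃[ z ] (Unit z × z ^ᶜ n ≈ᶜ 𝕚 × (0# ≤ 1# → ∀ {m} → m ℕ.≤ n → Quadrant (z ^ᶜ m)))
    𝕚-root = RootTower.nthRoot 𝕚 𝕚-unit (≈⇒0≤ refl) n 1≤n

  -- ζ = exp(πi/2n).
  ζ : ℂ
  ζ = proj₁ 𝕚-root

  opaque
    ζ-unit : Unit ζ
    ζ-unit = proj₁ (proj₂ 𝕚-root)

    ζ^n : ζ ^ᶜ n ≈ᶜ 𝕚
    ζ^n = proj₁ (proj₂ (proj₂ 𝕚-root))

    ζ-quadrant : ∀ {m} → m ℕ.≤ n → Quadrant (ζ ^ᶜ m)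
    ζ-quadrant = proj₂ (proj₂ (proj₂ 𝕚-root)) 0≤1

    ζ-quadrant₁ : Quadrant ζ
    ζ-quadrant₁ = Quadrant-resp (*ᶜ-identityʳ ζ) (ζ-quadrant {1} 1≤n)

    -- Im ζᵐ⁺¹ = Re ζ Im ζᵐ + Im ζ Re ζᵐ, so one of the summands is positive: either Im ζ > 0 at
    -- once, or the exponent drops, and it cannot reach 0 because Im 1 = 0.
    im-ζ^>0⇒im-ζ>0 : ∀ m → m ℕ.≤ n → 0# < im (ζ ^ᶜ m) → 0# < im ζ
    im-ζ^>0⇒im-ζ>0 zero    m≤n 0<0 = ⊥-elim (<-irrefl refl 0<0)
    im-ζ^>0⇒im-ζ>0 (suc m) m<n 0<im =
      [ (λ p → im-ζ^>0⇒im-ζ>0 m (ℕ.<⇒≤ m<n) (0<-*⁻ʳ (proj₁ ζ-quadrant₁) p))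
      , (λ p → 0<-*⁻ˡ (proj₂ ζ-quadrant₁) p) ]′ (0<-+⁻ 0<im)

    im-ζ>0 : 0# < im ζ
    im-ζ>0 = im-ζ^>0⇒im-ζ>0 n ℕ.≤-refl (<-respʳ (sym (proj₂ ζ^n)) 0<1)

    Unit⇒sine² : ∀ {z} → Unit z → im z * im z ≈ (1# + re z) * (1# - re z)
    Unit⇒sine² {x +i y} u = sym (trans
      (solve 2 (λ x y → (con (+ 1) :+ x) :* (con (+ 1) :- x)
          := y :* y :+ (:- con (+ 1)) :* (x :* x :+ y :* y :- con (+ 1))) refl x y)
      (drop-0 _ _ (-≈0 u)))

    re-ζ<1 : 0# < 1# - re ζ
    re-ζ<1 = 0<-*⁻ʳ (re≥-1 ζ-unit) (<-respʳ (Unit⇒sine² ζ-unit) (*-pos im-ζ>0 im-ζ>0))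

    -- In the quadrant, multiplying ζ by ζᵐ cannot increase its real part, so Re ζᵐ⁺¹ ≤ Re ζ < 1.
    -- Then Im² = (1 + Re)(1 - Re) is positive.
    im-ζ^>0 : ∀ {m} → m ℕ.< n → 0# < im (ζ ^ᶜ suc m)
    im-ζ^>0 {m} m<n = 0<-*⁻ˡ (proj₂ (ζ-quadrant m<n))
      (<-respʳ (sym (Unit⇒sine² (Unit-^ ζ-unit (suc m))))
          (*-pos (0<-+ 0<1 (proj₁ (ζ-quadrant m<n))) re<1))
      where
      re<1 : 0# < 1# - re (ζ ^ᶜ suc m)
      re<1 = <-respʳ
        (solve 4 (λ x y a b → (con (+ 1) :- x) :+ (x :* (con (+ 1) :- a) :+ y :* b)
            := con (+ 1) :- (x :* a :- y :* b)) refl (re ζ) (im ζ) (re (ζ ^ᶜ m)) (im (ζ ^ᶜ m)))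
        (0<-+ re-ζ<1 (0≤-+ (0≤-* (proj₁ ζ-quadrant₁) (re≤1 (Unit-^ ζ-unit m)))
          (0≤-* (proj₂ ζ-quadrant₁) (proj₂ (ζ-quadrant (ℕ.<⇒≤ m<n))))))

    -- On the unit circle a b = i means that a is i times the conjugate of b: the two angles add up
    -- to a right angle.
    complement : ∀ {a b} → Unit b → a *ᶜ b ≈ᶜ 𝕚 → re a ≈ im b
    complement {x +i y} {z +i w} u (r≈0 , i≈1) = sym (trans
      (solve 4 (λ x y z w → w := x :+ x :* (z :* z :+ w :* w :- con (+ 1)) :+ (:- z) :*
          (x :* z :- y :* w) :+ (:- w) :* (x :* w :+ y :* z :- con (+ 1))) refl x y z w)
      (trans (drop-0 _ _ (-≈0 i≈1)) (trans (drop-0 _ _ r≈0) (drop-0 _ _ (-≈0 u)))))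

    re-ζ^>0 : ∀ {m} → m ℕ.< n → 0# < re (ζ ^ᶜ m)
    re-ζ^>0 {m} m<n = <-respʳ (sym (complement (Unit-^ ζ-unit (suc k)) product≈𝕚)) (im-ζ^>0 k<n)
      where
      k : ℕ
      k = n ℕ.∸ suc m
      m+k+1≡n : m ℕ.+ suc k ≡ n
      m+k+1≡n = ≡.trans (ℕ.+-suc m k) (ℕ.m+[n∸m]≡n m<n)
      k<n : k ℕ.< n
      k<n = ℕ.≤-trans (ℕ.m≤n+m (suc k) m) (ℕ.≤-reflexive m+k+1≡n)
      product≈𝕚 : ζ ^ᶜ m *ᶜ ζ ^ᶜ suc k ≈ᶜ 𝕚
      product≈𝕚 = ℂR.trans (ℂR.sym (^ᶜ-homo-* ζ m (suc k))) (ℂR.trans (^ᶜ-congʳ ζ m+k+1≡n) ζ^n)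

  fourth : ℂ → ℂ
  fourth z = (z *ᶜ z) *ᶜ (z *ᶜ z)

  ω : ℂ
  ω = fourth ζ

  opaque
    fourth-cong : ∀ {z w} → z ≈ᶜ w → fourth z ≈ᶜ fourth w
    fourth-cong e = *ᶜ-cong (*ᶜ-cong e e) (*ᶜ-cong e e)

    fourth-^ : ∀ z d → fourth z ^ᶜ d ≈ᶜ fourth (z ^ᶜ d)
    fourth-^ z d = ℂR.trans (^ᶜ-distrib-* (z *ᶜ z) (z *ᶜ z) d) (*ᶜ-cong (^ᶜ-distrib-* z z d)
        (^ᶜ-distrib-* z z d))

    𝕚-square : 𝕚 *ᶜ 𝕚 ≈ᶜ -ᶜ 1ᶜ
    𝕚-square =
      solve 0 (con (+ 0) :* con (+ 0) :- con (+ 1) :* con (+ 1) := :- con (+ 1)) refl ,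
      solve 0 (con (+ 0) :* con (+ 1) :+ con (+ 1) :* con (+ 0) := :- con (+ 0)) refl

    -ᶜ‿*-1 : ∀ z → -ᶜ z *ᶜ -ᶜ 1ᶜ ≈ᶜ z
    -ᶜ‿*-1 (x +i y) =
      solve 2 (λ x y → (:- x) :* (:- con (+ 1)) :- (:- y) :* (:- con (+ 0)) := x) refl x y ,
      solve 2 (λ x y → (:- x) :* (:- con (+ 0)) :+ (:- y) :* (:- con (+ 1)) := y) refl x y

    fourth-𝕚 : fourth 𝕚 ≈ᶜ 1ᶜ
    fourth-𝕚 = ℂR.trans (*ᶜ-cong 𝕚-square 𝕚-square) (-ᶜ‿*-1 1ᶜ)

    -- |z⁴ − 1| = 4 |x y| for z = x + i y on the unit circle.
    fourth-apart : ∀ {z} → Unit z → 0# < re z → 0# < im z → Apart (fourth z) 1ᶜ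
    fourth-apart {x +i y} u 0<x 0<y = <-respʳ
        (sym (trans identity₁ (identity₂ _ (trans (*-cong u u) (*-identityˡ 1#)))))
      (*-pos (*-pos (*-pos 0<2 0<2) (*-pos 0<2 0<2)) (*-pos (*-pos 0<x 0<x) (*-pos 0<y 0<y)))
      where
      N : Carrier
      N = (x * x + y * y) * (x * x + y * y)
      X : Carrier
      X = (1# + 1#) * (1# + 1#) * ((1# + 1#) * (1# + 1#)) * (x * x * (y * y))
      -- In an identity valid for all x and y, `P` is the cofactor of |z|⁴ - 1; on the unit circle
      -- only `X`, that is 16 x² y², remains.
      P : Carrier
      P = re (fourth (x +i y)) + re (fourth (x +i y)) - N - 1#
      identity₁ : normSq (fourth (x +i y) -ᶜ 1ᶜ) ≈ X * N + P * (N - 1#)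
      identity₁ = solve 2 (λ x y → let z2r = x :* x :- y :* y ; z2i = x :* y :+ y :* x
                                       r = z2r :* z2r :- z2i :* z2i ; i = z2r :* z2i :+ z2i :* z2r
                                       n = (x :* x :+ y :* y) :* (x :* x :+ y :* y) in
        (r :- con (+ 1)) :* (r :- con (+ 1)) :+ (i :- con (+ 0)) :* (i :- con (+ 0))
          := con (+ 2) :* con (+ 2) :* (con (+ 2) :* con (+ 2)) :* (x :* x :* (y :* y)) :* n :+
              (r :+ r :- n :- con (+ 1)) :* (n :- con (+ 1))) refl x y
      identity₂ : ∀ {M} P → M ≈ 1# → X * M + P * (M - 1#) ≈ X
      identity₂ P M≈1 = trans (drop-0 _ P (-≈0 M≈1)) (trans (*-congˡ M≈1) (*-identityʳ X))

    ω-unit : Unit ω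
    ω-unit = Unit-* (Unit-* ζ-unit ζ-unit) (Unit-* ζ-unit ζ-unit)

    ω^n≈1 : ω ^ᶜ n ≈ᶜ 1ᶜ
    ω^n≈1 = ℂR.trans (fourth-^ ζ n) (ℂR.trans (fourth-cong ζ^n) fourth-𝕚)

    ω^-apart : ∀ {d} → suc d ℕ.< n → Apart (ω ^ᶜ suc d) 1ᶜ
    ω^-apart {d} d<n = <-respʳ (normSq-cong (ℂR.+-congʳ (ℂR.sym (fourth-^ ζ (suc d)))))
      (fourth-apart (Unit-^ ζ-unit (suc d)) (re-ζ^>0 d<n) (im-ζ^>0 (ℕ.<⇒≤ d<n)))

    -- Cotransitivity at -1/2 < 0 gives two overlapping cases. If Re g > -1/2, one bisection leads
    -- to the right half circle, and the root found there is squared. If Re g < 0, then -g is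
    -- already there, and ζ² is an n-th root of -1.
    anyRoot : ∀ {g} → Unit g → ∃[ r ] (Unit r × r ^ᶜ n ≈ᶜ g)
    anyRoot {g} u = [ right , left ]′ (<-cotrans (re g) (0<-⇒<0 {x = - ½} (<-respʳ (solve 1 (λ h → h
        := :- (:- h)) refl ½) 0<½)))
      where
      right : - ½ < re g → ∃[ r ] (Unit r × r ^ᶜ n ≈ᶜ g)
      right -½<re =
        let p = principalRoot u (0<⇒0≤ (<-respʳ (solve 2 (λ h x → x :- (:- h)
                := x :+ h) refl ½ (re g)) (<⇒0< -½<re)))
            t , ut , t^n≈ , _ = RootTower.nthRoot (root p) (root-unit u p) (root-re≥0 u p) n 1≤n
        in t *ᶜ t , Unit-* ut ut ,
           ℂR.trans (^ᶜ-distrib-* t t n) (ℂR.trans (*ᶜ-cong t^n≈ t^n≈) (root-square u p))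
      left : re g < 0# → ∃[ r ] (Unit r × r ^ᶜ n ≈ᶜ g)
      left re<0 =
        let t , ut , t^n≈ , _ = RootTower.nthRoot (-ᶜ g)
              (trans (solve 2 (λ x y → (:- x) :* (:- x) :+ (:- y) :* (:- y)
                  := x :* x :+ y :* y) refl (re g) (im g)) u)
              (0<⇒0≤ (<0⇒0< re<0)) n 1≤n
        in t *ᶜ (ζ *ᶜ ζ) , Unit-* ut (Unit-* ζ-unit ζ-unit) ,
           ℂR.trans (^ᶜ-distrib-* t (ζ *ᶜ ζ) n) (ℂR.trans
             (*ᶜ-cong t^n≈ (ℂR.trans (^ᶜ-distrib-* ζ ζ n) (ℂR.trans (*ᶜ-cong ζ^n ζ^n) 𝕚-square)))
             (-ᶜ‿*-1 g))

    1ᶜ^ : ∀ k → 1ᶜ ^ᶜ k ≈ᶜ 1ᶜ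
    1ᶜ^ zero    = ℂR.refl
    1ᶜ^ (suc k) = ℂR.trans (*ᶜ-identityˡ (1ᶜ ^ᶜ k)) (1ᶜ^ k)

  rotations : ℂ → Vector ℂ n
  rotations r i = r *ᶜ ω ^ᶜ toℕ i

  module _ {g r : ℂ} (u : Unit r) (r^n≈g : r ^ᶜ n ≈ᶜ g) where
    opaque
      rotation-root : ∀ i → rotations r i ^ᶜ n ≈ᶜ g
      rotation-root i = ℂR.trans (^ᶜ-distrib-* r (ω ^ᶜ toℕ i) n) (ℂR.trans
        (*ᶜ-cong r^n≈g (ℂR.trans (^ᶜ-assocʳ ω (toℕ i) n) (ℂR.trans (^ᶜ-congʳ ω (ℕ.*-comm (toℕ i) n))
          (ℂR.trans (ℂR.sym (^ᶜ-assocʳ ω n (toℕ i))) (ℂR.trans (^ᶜ-congˡ (toℕ i) ω^n≈1)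
              (1ᶜ^ (toℕ i)))))))
        (*ᶜ-identityʳ g))

      rotation-unit : ∀ i → Unit (rotations r i)
      rotation-unit i = Unit-* {r} {ω ^ᶜ toℕ i} u (Unit-^ ω-unit (toℕ i))

      -- Multiplication by a unit number is an isometry, so the distance of two rotations depends
      -- only on the difference of their exponents.
      ω^-distance : ∀ a d → normSq (r *ᶜ ω ^ᶜ (a ℕ.+ d) -ᶜ r *ᶜ ω ^ᶜ a) ≈ normSq (ω ^ᶜ d -ᶜ 1ᶜ)
      ω^-distance a d = trans
        (normSq-cong (ℂR.trans (ℂR.+-congʳ (ℂR.*-congˡ {x = r} (^ᶜ-homo-* ω a d)))
            (factor r (ω ^ᶜ a) (ω ^ᶜ d))))
        (trans (normSq-* (r *ᶜ ω ^ᶜ a) (ω ^ᶜ d -ᶜ 1ᶜ))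
        (trans (*-congʳ (Unit-* {r} {ω ^ᶜ a} u (Unit-^ ω-unit a))) (*-identityˡ _)))

      rotation-apart-< : ∀ {a b} → a ℕ.< b → b ℕ.< n → Apart (r *ᶜ ω ^ᶜ b) (r *ᶜ ω ^ᶜ a)
      rotation-apart-< {a} {b} a<b b<n = ≡.subst (λ b → Apart (r *ᶜ ω ^ᶜ b) (r *ᶜ ω ^ᶜ a)) a+d+1≡b
        (<-respʳ (sym (ω^-distance a (suc d))) (ω^-apart d<n))
        where
        d : ℕ
        d = b ℕ.∸ suc a
        a+d+1≡b : a ℕ.+ suc d ≡ b
        a+d+1≡b = ≡.trans (ℕ.+-suc a d) (ℕ.m+[n∸m]≡n a<b)
        d<n : suc d ℕ.< n
        d<n = ℕ.≤-<-trans (ℕ.≤-trans (ℕ.m≤n+m (suc d) a) (ℕ.≤-reflexive a+d+1≡b)) b<n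

      rotation-apart : ∀ i j → i ≢ j → Apart (rotations r i) (rotations r j)
      rotation-apart i j i≢j with ℕ.<-cmp (toℕ i) (toℕ j)
      ... | tri< i<j _ _ = Apart-sym {rotations r j} {rotations r i} (rotation-apart-< i<j
          (Fin.toℕ<n j))
      ... | tri≈ _ i≡j _ = ⊥-elim (i≢j (Fin.toℕ-injective i≡j))
      ... | tri> _ _ j<i = rotation-apart-< j<i (Fin.toℕ<n i)

-- Spectrum and spectral radius of the gain cycle

module CycleSpectrum {c ℓ₁ ℓ₂} (ℝ : Reals c ℓ₁ ℓ₂) (m : ℕ)
  (Φ : Complex.GainDigraph ℝ (directedCycle (suc (suc m)))) where
  open RealNumbers ℝ
  open ComplexNumbers ℝ
  open ComplexApartness ℝ
  open Complex ℝ using (module 𝕋; gain; adjacency; cycleGain; charPoly; identity; product;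
    _HasModulus_; IsEigenvalue; IsSpectralRadius; SpecIsSet)
  open IntegerRingSolver commutativeRing
  private
    module ℂR = CommutativeRing ℂ-commutativeRing
    module ∑ = Algebra.Properties.Semiring.Sum semiring

  n : ℕ
  n = suc (suc m)

  open CyclicMatrix ℂ-commutativeRing using
      (det-cyclic; cyclic-*ᵥ; cyclicEigenvector; cyclicEigenvector-next)
  open MonicPolynomial ℂ-commutativeRing using (power-roots)
  open RootsOfUnity ℝ n (s≤s z≤n)

  A : Matrix ℂ n
  A = adjacency Φ

  φ : Vector ℂ n
  φ i = 𝕋.value (gain Φ i (next i) ≡.refl)

  g : ℂ
  g = cycleGain Φ

  φ-unit : ∀ i → Unit (φ i)
  φ-unit i = trans (sym (proj₂ (𝕋.modulus (gain Φ i (next i) ≡.refl)))) (*-identityˡ 1#)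

  product-unit : ∀ {k} (f : Vector ℂ k) → (∀ i → Unit (f i)) → Unit (product f)
  product-unit {zero}  f u = Unit-1
  product-unit {suc k} f u = Unit-* {f zero} {product (f ∘ suc)} (u zero) (product-unit (f ∘ suc)
      (u ∘ suc))

  g-unit : Unit g
  g-unit = product-unit φ φ-unit

  A-next : ∀ i → A i (next i) ≈ᶜ φ i
  A-next i with next i Fin.≟ next i
  ... | yes _    = ℂR.refl
  ... | no  ≢next = ⊥-elim (≢next ≡.refl)

  A-other : ∀ i j → j ≢ next i → A i j ≈ᶜ 0ᶜ
  A-other i j j≢next with j Fin.≟ next i
  ... | yes j≡next = ⊥-elim (j≢next j≡next)
  ... | no  _      = ℂR.refl

  -- With at least two vertices the cycle has no loop, so the diagonal of zI - A is exactly z.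
  next≢ : (i : Fin n) → i ≢ next i
  next≢ i eq with view i
  ... | ‵fromℕ    = Fin.0≢1+n (≡.sym (≡.trans eq (next-fromℕ (suc m))))
  ... | ‵inject₁ j = ℕ.1+n≢n (≡.sym (≡.trans (≡.sym (Fin.toℕ-inject₁ j))
      (≡.cong toℕ (≡.trans eq (next-inject₁ j)))))

  identity-diagonal : (i : Fin n) → identity i i ≈ᶜ 1ᶜ
  identity-diagonal i with i Fin.≟ i
  ... | yes _  = ℂR.refl
  ... | no i≢i = ⊥-elim (i≢i ≡.refl)

  identity-other : (i j : Fin n) → j ≢ i → identity i j ≈ᶜ 0ᶜ
  identity-other i j j≢i with i Fin.≟ j
  ... | yes i≡j = ⊥-elim (j≢i (≡.sym i≡j))
  ... | no  _   = ℂR.refl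

  opaque
    charPoly-cycle : ∀ z → charPoly A z ≈ᶜ z ^ᶜ n -ᶜ g
    charPoly-cycle z = det-cyclic (λ i j → z *ᶜ identity i j +ᶜ -ᶜ A i j) z φ
      (λ i → ℂR.trans (ℂR.+-cong (ℂR.*-congˡ (identity-diagonal i)) (ℂR.-‿cong (A-other i i (next≢ i))))
          (z*1-0 z))
      (λ i → ℂR.trans (ℂR.+-cong (ℂR.*-congˡ (identity-other i (next i) (next≢ i ∘ ≡.sym)))
          (ℂR.-‿cong (A-next i))) (z*0-w z (φ i)))
      (λ i j j≢i j≢next → ℂR.trans (ℂR.+-cong (ℂR.*-congˡ (identity-other i j j≢i))
          (ℂR.-‿cong (A-other i j j≢next))) (ℂR.trans (z*0-w z 0ᶜ) -0≈0))
      where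
      -0≈0 : -ᶜ 0ᶜ ≈ᶜ 0ᶜ
      -0≈0 = ℂR.trans (ℂR.sym (ℂR.+-identityˡ _)) (ℂR.-‿inverseʳ 0ᶜ)
      z*0-w : ∀ z w → z *ᶜ 0ᶜ +ᶜ -ᶜ w ≈ᶜ -ᶜ w
      z*0-w z w = ℂR.trans (ℂR.+-congʳ (ℂR.zeroʳ z)) (ℂR.+-identityˡ (-ᶜ w))
      z*1-0 : ∀ z → z *ᶜ 1ᶜ +ᶜ -ᶜ 0ᶜ ≈ᶜ z
      z*1-0 z = ℂR.trans (ℂR.+-cong (*ᶜ-identityʳ z) -0≈0) (ℂR.+-identityʳ z)

    r-exists : ∃[ r ] (Unit r × r ^ᶜ n ≈ᶜ g)
    r-exists = anyRoot g-unit

  r : ℂ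
  r = proj₁ r-exists

  r-unit : Unit r
  r-unit = proj₁ (proj₂ r-exists)

  r^n≈g : r ^ᶜ n ≈ᶜ g
  r^n≈g = proj₂ (proj₂ r-exists)

  μ : Vector ℂ n
  μ = rotations r

  μ-root : ∀ i → μ i ^ᶜ n ≈ᶜ g
  μ-root = rotation-root r-unit r^n≈g

  μ-unit : ∀ i → Unit (μ i)
  μ-unit = rotation-unit r-unit r^n≈g

  μ-apart : ∀ i j → i ≢ j → Apart (μ i) (μ j)
  μ-apart = rotation-apart r-unit r^n≈g

  opaque
    power-factors : ∀ z → z ^ᶜ n -ᶜ g ≈ᶜ product (λ i → z -ᶜ μ i)
    power-factors = power-roots g μ μ-root (λ i j i≢j x → normSq-pos-cancel {μ i -ᶜ μ j} {x}
        (μ-apart i j i≢j))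

    spectrum : SpecIsSet A (λ z → z ^ᶜ n ≈ᶜ g)
    spectrum = μ , (λ z → ℂR.trans (charPoly-cycle z) (power-factors z)) ,
      (λ i j i≢j → Apart⇒# (μ-apart i j i≢j)) , λ z → mk⇔
        (λ z^n≈g → product-zero μ μ-apart z (ℂR.trans (ℂR.sym (power-factors z))
          (ℂR.trans (ℂR.+-congʳ z^n≈g) (ℂR.-‿inverseʳ g))))
        (λ (i , z≈μi) → ℂR.trans (^ᶜ-congˡ n z≈μi) (μ-root i))

    eigenvalue : IsEigenvalue A (μ zero)
    -- The entry at vertex 0 is the full product g, of modulus 1 and therefore apart from 0.
    eigenvalue = v , (zero , Apart⇒# (<-respʳ (sym v₀-norm) 0<1)) ,
      λ i → ℂR.trans (cyclic-*ᵥ A φ A-next A-other v i) (cyclicEigenvector-next φ (μ zero)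
          (μ-root zero) i)
      where
      v : Vector ℂ n
      v = cyclicEigenvector φ (μ zero)
      v₀-norm : normSq (v zero -ᶜ 0ᶜ) ≈ 1#
      v₀-norm = trans (normSq-cong (ℂR.trans (ℂR.+-congʳ (*ᶜ-identityˡ g))
        (solve 1 (λ x → x :- con (+ 0) := x) refl (re g) , solve 1 (λ x → x :- con (+ 0)
            := x) refl (im g)))) g-unit

    sum-≥0 : ∀ {k} (f : Vector Carrier k) → (∀ i → 0# ≤ f i) → 0# ≤ ∑.sum f
    sum-≥0 {zero}  f f≥0 = ≈⇒0≤ refl
    sum-≥0 {suc k} f f≥0 = 0≤-+ (f≥0 zero) (sum-≥0 (f ∘ suc) (f≥0 ∘ suc))

    sum-pos : ∀ {k} (f : Vector Carrier k) → (∀ i → 0# ≤ f i) → ∀ i → 0# < f i → 0# < ∑.sum f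
    sum-pos f f≥0 zero    0<fi = 0<-+ 0<fi (sum-≥0 (f ∘ suc) (f≥0 ∘ suc))
    sum-pos f f≥0 (suc i) 0<fi = <-respʳ (+-comm _ _) (0<-+ (sum-pos (f ∘ suc) (f≥0 ∘ suc) i 0<fi)
        (f≥0 zero))

    -- The sum over the cycle replaces an entry of largest modulus, which cannot be selected
    -- constructively. If ρ > 1, then (ρ² - 1) times the sum of the |vᵢ|² is 0, so the sum is 0,
    -- although one of its terms is positive.
    eigenvalue-bound : ∀ l ρ → IsEigenvalue A l → l HasModulus ρ → ρ ≤ 1#
    eigenvalue-bound l ρ (v , (i , vi#0) , Av≈lv) (0≤ρ , ρ²≈) 1<ρ =
      <-irrefl (sym (*-cancel 0<ρ²-1 scaled)) total>0
      where
      V : Vector Carrier n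
      V i = normSq (v i)
      V-next : ∀ i → V (next i) ≈ ρ * ρ * V i
      V-next i =
        trans (sym (trans (normSq-* (φ i) (v (next i))) (trans (*-congʳ (φ-unit i)) (*-identityˡ _))))
        (trans (normSq-cong (ℂR.trans (ℂR.sym (cyclic-*ᵥ A φ A-next A-other v i)) (Av≈lv i)))
        (trans (normSq-* l (v i)) (*-congʳ (sym ρ²≈))))
      total>0 : 0# < ∑.sum V
      total>0 = sum-pos V (λ i → normSq-≥0 (v i)) i
        (<-respʳ (normSq-cong {v i -ᶜ 0ᶜ} {v i} (solve 1 (λ x → x :- con (+ 0)
            := x) refl (re (v i)) , solve 1 (λ x → x :- con (+ 0) := x) refl (im (v i))))
            (#⇒Apart vi#0))
      0<ρ²-1 : 0# < ρ * ρ - 1#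
      0<ρ²-1 = <-respʳ (solve 1 (λ x → (x :- con (+ 1)) :* ((x :- con (+ 1)) :+ con (+ 2))
          := x :* x :- con (+ 1)) refl ρ)
        (*-pos (<⇒0< 1<ρ) (0<-+ (<⇒0< 1<ρ) (0<⇒0≤ 0<2)))
      total : ρ * ρ * ∑.sum V ≈ ∑.sum V
      total = trans (∑.*-distribˡ-sum (ρ * ρ) V) (trans (∑.sum-cong-≋ (λ i → sym (V-next i)))
        (CyclicMatrix.sum-next commutativeRing V))
      scaled : (ρ * ρ - 1#) * ∑.sum V ≈ 0#
      scaled = trans (solve 2 (λ p s → (p :- con (+ 1)) :* s
          := p :* s :- s) refl (ρ * ρ) (∑.sum V)) (-≈0 total)

    spectralRadius : IsSpectralRadius A 1#
    spectralRadius = (μ zero , eigenvalue , 0≤1 , trans (*-identityˡ 1#)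
        (sym (μ-unit zero))) , eigenvalue-bound

open import Data.Nat.Base using (_≤_)

theorem4p1 : ∀ {c ℓ₁ ℓ₂} (ℝ : Reals c ℓ₁ ℓ₂) → let open Complex ℝ in
    (n : ℕ) → 2 ≤ n → (Φ : GainDigraph (directedCycle n)) →
    SpecIsSet (adjacency Φ) (λ z → z ^ n ≈ cycleGain Φ)
    × IsSpectralRadius (adjacency Φ) (Reals.1# ℝ)
theorem4p1 ℝ (suc (suc m)) (s≤s (s≤s z≤n)) Φ =
    CycleSpectrum.spectrum ℝ m Φ , CycleSpectrum.spectralRadius ℝ m Φ
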